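{- Let $n>1$ be a positive integer with $n\equiv 1\pmod{3}$. Then \begin{align*} \sum_{k=0}^{(n-1)/3} [6k+1]\frac{(q;q^3)_k^6\, (q^3;q^3)_{2k}}{(q^3;q^3)_k^6\, (q^2;q^3)_{2k}}\, q^{2k} &\equiv 0 \pmod{\Phi_n(q)},\\ \sum_{k=0}^{(n-1)/3} [6k+1]\frac{(q;q^3)_k^4\, (q^3;q^3)_{2k}}{(q^3;q^3)_k^4\, (q^2;q^3)_{2k}} &\equiv 0 \pmod{\Phi_n(q)},\\ \sum_{k=0}^{(n-1)/3} [6k+1]\frac{(q;q^3)_k^2\, (q^3;q^3)_{2k}}{(q^3;q^3)_k^2\, (q^2;q^3)_{2k}}\, q^{ -2k} &\equiv 0 \pmod{\Phi_n(q)}. \end{align*}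
   Context: Here $q$ is an indeterminate. For $x$ and a base $p$ (a power of $q$), $(x;p)_k=\prod_{j=0}^{k-1}(1-xp^j)$ for integers $k\ge0$. The $q$-integer is $[j]=1+q+\cdots+q^{j-1}$ and $\Phi_n(q)$ is the $n$-th cyclotomic polynomial. For rational functions $A(q),B(q)$ and a polynomial $P(q)$, $A\equiv B\pmod{P}$ means that the numerator of the reduced form of $A-B$ is divisible by $P$ in $\mathbb{Z}[q]$. -}

module Defs where

open import Data.Bool using (Bool; true; false)
open import Data.Nat as ℕ using (ℕ; zero; suc; _∸_; _≤ᵇ_)
open import Data.Nat.Divisibility using (_∣?_)
open import Data.Integer as ℤ using (ℤ; 0ℤ; 1ℤ; -1ℤ)
open import Data.List using (List; []; _∷_; map; foldr; length; reverse; replicate; filter; upTo; _++_)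
open import Data.List.Relation.Unary.All using (All)
open import Data.Product using (∃; ∃-syntax; _×_)
open import Relation.Binary.PropositionalEquality using (_≡_)
open import Relation.Nullary using (¬_)

-- Polynomials in ℤ[q], as coefficient lists (lowest degree first).

Poly : Set
Poly = List ℤ

infixl 6 _+P_ _-P_
infixl 7 _*P_

_+P_ : Poly → Poly → Poly
[]       +P q        = q
p        +P []       = p
(a ∷ p)  +P (b ∷ q)  = (a ℤ.+ b) ∷ (p +P q)

negP : Poly → Poly
negP = map (λ x → ℤ.- x)

_-P_ : Poly → Poly → Poly
p -P q = p +P negP q

_*P_ : Poly → Poly → Poly
[]      *P q = []
(a ∷ p) *P q = map (a ℤ.*_) q +P (0ℤ ∷ (p *P q))

zeroP oneP : Poly
zeroP = []
oneP  = 1ℤ ∷ []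

qpow : ℕ → Poly
qpow m = replicate m 0ℤ ++ (1ℤ ∷ [])

powP : Poly → ℕ → Poly
powP p zero    = oneP
powP p (suc k) = p *P powP p k

prodP : List Poly → Poly
prodP = foldr _*P_ oneP

sumP : List Poly → Poly
sumP = foldr _+P_ zeroP

IsZeroP : Poly → Set
IsZeroP p = All (_≡ 0ℤ) p

infix 4 _≈P_ _∣P_
_≈P_ : Poly → Poly → Set
p ≈P q = IsZeroP (p -P q)

_∣P_ : Poly → Poly → Set
a ∣P b = ∃[ c ] (c *P a ≈P b)

CoprimeP : Poly → Poly → Set
CoprimeP a b = ∀ c → c ∣P a → c ∣P b → c ∣P oneP

-- Cyclotomic polynomials, defined recursively by
--   q^n - 1 = ∏_{d ∣ n} Φ_d(q),  i.e.  Φ_n = (q^n - 1) / ∏_{d ∣ n, d < n} Φ_d,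
-- using exact long division by a monic polynomial.

private
  isZeroᵇ : ℤ → Bool
  isZeroᵇ (ℤ.+ zero) = true
  isZeroᵇ _          = false

  -- strip leading zeros of a highest-degree-first list
  stripH : List ℤ → List ℤ
  stripH []       = []
  stripH (x ∷ xs) with isZeroᵇ x
  ... | true  = stripH xs
  ... | false = x ∷ xs

  subH : List ℤ → List ℤ → List ℤ
  subH (x ∷ xs) (y ∷ ys) = (x ℤ.- y) ∷ subH xs ys
  subH xs       []       = xs
  subH []       (_ ∷ _)  = []

  -- synthetic division (highest degree first) by the monic polynomial 1 ∷ ds;
  -- returns the quotient, highest degree first
  qdiv : ℕ → List ℤ → List ℤ → List ℤ
  qdiv zero    ds a       = []
  qdiv (suc f) ds []      = []
  qdiv (suc f) ds (c ∷ a) with length ds ≤ᵇ length a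
  ... | true  = c ∷ qdiv f ds (subH a (map (c ℤ.*_) ds))
  ... | false = []

  tailL : List ℤ → List ℤ
  tailL []       = []
  tailL (_ ∷ xs) = xs

divMonic : Poly → Poly → Poly
divMonic p d = reverse (qdiv (length hp) (tailL (stripH (reverse d))) hp)
  where hp = stripH (reverse p)

properDivisors : ℕ → List ℕ
properDivisors n = filter (_∣? n) (map suc (upTo (n ∸ 1)))

cycF : ℕ → ℕ → Poly
cycF zero    n = oneP
cycF (suc f) n = divMonic (qpow n -P oneP) (prodP (map (cycF f) (properDivisors n)))

-- Φ_n(q), the n-th cyclotomic polynomial (meaningful for n ≥ 1)
Φ : ℕ → Poly
Φ n = cycF n n

qint : ℕ → Poly
qint j = replicate j 1ℤ

poch : ℕ → ℕ → ℕ → Poly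
poch a b k = prodP (map (λ j → oneP -P qpow (a ℕ.+ b ℕ.* j)) (upTo k))

record RatF : Set where
  constructor _/_
  field
    num : Poly
    den : Poly
open RatF public

infixl 6 _+R_ _-R_
_+R_ : RatF → RatF → RatF
(a / b) +R (c / d) = ((a *P d) +P (c *P b)) / (b *P d)

_-R_ : RatF → RatF → RatF
(a / b) -R (c / d) = ((a *P d) -P (c *P b)) / (b *P d)

sumR : List RatF → RatF
sumR = foldr _+R_ (zeroP / oneP)

polyR : Poly → RatF
polyR p = p / oneP

ReducedForm : RatF → Poly → Poly → Set
ReducedForm A N D = ¬ IsZeroP D × (N *P den A ≈P num A *P D) × CoprimeP N D

_≡R_mod_ : RatF → RatF → Poly → Set
A ≡R B mod P = ∃[ N ] ∃[ D ] (ReducedForm (A -R B) N D × P ∣P N)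

termNum termDen : ℕ → ℕ → Poly
termNum e k = qint (6 ℕ.* k ℕ.+ 1) *P powP (poch 1 3 k) e *P poch 3 3 (2 ℕ.* k)
termDen e k = powP (poch 3 3 k) e *P poch 2 3 (2 ℕ.* k)

range : ℕ → List ℕ
range n = upTo (suc ((n ∸ 1) ℕ./ 3))

S₁ : ℕ → RatF
S₁ n = sumR (map (λ k → (termNum 6 k *P qpow (2 ℕ.* k)) / termDen 6 k) (range n))

S₂ : ℕ → RatF
S₂ n = sumR (map (λ k → termNum 4 k / termDen 4 k) (range n))

S₃ : ℕ → RatF
S₃ n = sumR (map (λ k → termNum 2 k / (termDen 2 k *P qpow (2 ℕ.* k))) (range n))

{-# OPTIONS --safe #-}

-- Put n = 3m + 1. Modulo Φ_n we have q^n = 1, so 1 - q^(a+3i) = -q^(a+3i) (1 - q^(3+3j)) whenever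
-- n divides a + 3(i + j + 1). Hence (q;q³)_k (q³;q³)_(m-k) and (q²;q³)_(2m-2k) (q³;q³)_(2k) are, up to
-- signs and powers of q, independent of k, and since [6k+1] + q^(6k+1) [6(m-k)+1] = [2n] = 0, the terms
-- with indices k and m - k cancel. Thus twice the sum vanishes modulo Φ_n.
--
-- No irreducibility is needed: Φ_n divides (q^n - 1)/(q^d - 1) for proper divisors d of n, so Φ_n and
-- q^j - 1 generate a nonzero integer when n does not divide j, and as Φ_n is primitive the factors
-- 1 - q^j of the denominators can be cancelled modulo Φ_n.

module Submission where

open import Defs
open import Algebra.Bundles using (AbelianGroup; CommutativeRing)
import Algebra.Properties.CommutativeMonoid.Sum
import Algebra.Properties.Semiring.Exp
import Algebra.Solver.Ring
open import Algebra.Solver.Ring.AlmostCommutativeRing using (_-Raw-AlmostCommutative⟶_; fromCommutativeRing)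
open import Algebra.Structures using (IsCommutativeRing)
open import Data.Bool using (true; false; T)
open import Data.Empty using (⊥-elim)
open import Data.Fin as Fin using (Fin; opposite; toℕ)
import Data.Fin.Permutation as Permutation
import Data.Fin.Properties as Fin
open import Data.Integer as ℤ using (ℤ; 0ℤ; 1ℤ; -1ℤ; +0; +[1+_]; -[1+_])
import Data.Integer.Divisibility.Signed as ℤ∣
import Data.Integer.Properties as ℤ
open import Data.List using (List; []; _∷_; _++_; applyUpTo; foldl; length; map; replicate; reverse; upTo)
import Data.List.Properties as List
open import Data.List.Membership.Propositional using (_∈_)
open import Data.List.Membership.Propositional.Properties
  using (∈-applyUpTo⁺; ∈-filter⁺; ∈-filter⁻; ∈-map⁺; ∈-map⁻; ∈-upTo⁺; ∈-upTo⁻)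
open import Data.List.Relation.Unary.All as All using (All; []; _∷_)
open import Data.List.Relation.Unary.AllPairs using ([]; _∷_)
open import Data.List.Relation.Unary.Any using (here; there)
open import Data.List.Relation.Unary.Unique.Propositional using (Unique)
import Data.List.Relation.Unary.Unique.Propositional.Properties as Unique
open import Data.Maybe as Maybe using (Maybe)
open import Data.Nat as ℕ using (ℕ; zero; suc; _<_; _%_; _≤ᵇ_)
import Data.Nat.Divisibility as ℕ∣
import Data.Nat.DivMod as ℕ
open import Data.Nat.GCD using (gcd; gcd-GCD; gcd[m,n]∣m; gcd[m,n]∣n; module Bézout)
open import Data.Nat.Induction using (<-rec)
import Data.Nat.ListAction as ℕ
open import Data.Nat.Primality using (Prime; euclidsLemma; prime⇒nonZero)
open import Data.Nat.Primality.Factorisation using (PrimeFactorisation; factorise)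
import Data.Nat.Properties as ℕ
open import Data.Nat.Tactic.RingSolver using (solve-∀)
open import Data.Product using (∃-syntax; _×_; _,_; proj₁; proj₂)
open import Data.Sum as Sum using (_⊎_; inj₁; inj₂)
open import Data.Unit using (tt)
open import Function using (flip; id; _∋_)
open import Level using (0ℓ)
open import Relation.Binary.Consequences using (dec⇒weaklyDec)
open import Relation.Binary.PropositionalEquality as ≡ using (_≡_; _≢_)
import Relation.Binary.Reasoning.Setoid
open import Relation.Nullary using (¬_; Dec; yes; no)

-- Write 2h for the exponent 6, 4 or 2. The extra powers q^(2k), 1 and q^(-2k) are then q^(2(h-2)k),
-- and this choice is what makes the terms at k and l = m - k match: after reflection their powers
-- of q have exponents E(k,l) and E(l,k) with E(k,l) + (6k+1) - E(l,k) = ((h-2)(k-l) + 1) n. Two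
-- obstacles lie outside this computation. The congruence speaks of a reduced form whose coprimality
-- is meant in ℤ[q], where integers are not units; a Bézout relation up to integer factors does not
-- suffice, and Gauss's lemma has to distribute those factors. Moreover Φ_n is the output of a
-- division algorithm on coefficient lists, about which nothing is known until the division is shown
-- to be exact. For that, the Φ_d of the proper divisors d must divide q^n - 1 jointly, so their
-- comaximality is part of the same induction.

ℤ-Algebra : CommutativeRing 0ℓ 0ℓ → Set
ℤ-Algebra R = ℤ.+-*-rawRing -Raw-AlmostCommutative⟶ fromCommutativeRing R

-- Divisibility, primitivity and cancellation in a commutative ring

module Algebraic (R : CommutativeRing 0ℓ 0ℓ) (ι : ℤ-Algebra R) where
  open CommutativeRing R public hiding (zero)
  open Algebra.Properties.Semiring.Exp semiring public
  open _-Raw-AlmostCommutative⟶_ ι public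
  open Relation.Binary.Reasoning.Setoid setoid public

  private
    coeff≟ : ∀ a b → Maybe (⟦ a ⟧ ≈ ⟦ b ⟧)
    coeff≟ a b = Maybe.map (λ { ≡.refl → refl }) (dec⇒weaklyDec ℤ._≟_ a b)

  open Algebra.Solver.Ring ℤ.+-*-rawRing (fromCommutativeRing R) ι coeff≟ public
    using (solve; Polynomial; _:=_; _:+_; _:*_; _:-_; :-_; _:^_; con)

  -- con 1ℤ would denote ⟦ 1ℤ ⟧, which need not be 1# definitionally.
  :1 : ∀ {n} → Polynomial n
  :1 = con 0ℤ :^ 0

  infix 4 _∣_
  _∣_ : Carrier → Carrier → Set
  x ∣ y = ∃[ c ] c * x ≈ y

  ∣-resp : ∀ {x x′ y y′} → x ≈ x′ → y ≈ y′ → x ∣ y → x′ ∣ y′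
  ∣-resp x≈x′ y≈y′ (c , p) = c , trans (*-congˡ (sym x≈x′)) (trans p y≈y′)

  ∣-trans : ∀ {x y z} → x ∣ y → y ∣ z → x ∣ z
  ∣-trans (c , p) (d , q) = d * c , trans (*-assoc _ _ _) (trans (*-congˡ p) q)

  ∣n⇒∣m*n : ∀ {x} m {n} → x ∣ n → x ∣ m * n
  ∣n⇒∣m*n m (c , p) = m * c , trans (*-assoc _ _ _) (*-congˡ p)

  ∣m⇒∣m*n : ∀ {x m} n → x ∣ m → x ∣ m * n
  ∣m⇒∣m*n n x∣m = ∣-resp refl (*-comm n _) (∣n⇒∣m*n n x∣m)

  ∣m∣n⇒∣m+n : ∀ {x m n} → x ∣ m → x ∣ n → x ∣ m + n
  ∣m∣n⇒∣m+n (c , p) (d , q) = c + d , trans (distribʳ _ _ _) (+-cong p q)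

  x-x≈0 : ∀ x → x - x ≈ 0#
  x-x≈0 = -‿inverseʳ

  x-y≈0⇒x≈y : ∀ {x y} → x - y ≈ 0# → x ≈ y
  x-y≈0⇒x≈y {x} {y} e = begin
    x           ≈⟨ solve 2 (λ x y → x := x :- y :+ y) refl x y ⟩
    x - y + y   ≈⟨ +-congʳ e ⟩
    0# + y      ≈⟨ +-identityˡ y ⟩
    y           ∎

  1^ : ∀ n → 1# ^ n ≈ 1#
  1^ zero    = refl
  1^ (suc n) = trans (*-identityˡ _) (1^ n)

  ^-distrib-* : ∀ x y n → (x * y) ^ n ≈ x ^ n * y ^ n
  ^-distrib-* x y zero    = sym (*-identityˡ _)
  ^-distrib-* x y (suc n) = trans (*-congˡ (^-distrib-* x y n))
    (solve 4 (λ x y a b → (x :* y) :* (a :* b) := (x :* a) :* (y :* b)) refl x y (x ^ n) (y ^ n))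

  geometric : Carrier → ℕ → Carrier
  geometric x zero    = 0#
  geometric x (suc n) = 1# + x * geometric x n

  geometric-+ : ∀ x m n → geometric x (m ℕ.+ n) ≈ geometric x m + x ^ m * geometric x n
  geometric-+ x zero    n = trans (sym (*-identityˡ _)) (sym (+-identityˡ _))
  geometric-+ x (suc m) n = trans (+-congˡ (*-congˡ (geometric-+ x m n)))
    (solve 4 (λ x a b c → :1 :+ x :* (a :+ b :* c) := :1 :+ x :* a :+ x :* b :* c) refl
      x (geometric x m) (x ^ m) (geometric x n))

  geometric-telescopes : ∀ x n → (x - 1#) * geometric x n ≈ x ^ n - 1#
  geometric-telescopes x zero    = trans (zeroʳ _) (sym (x-x≈0 1#))
  geometric-telescopes x (suc n) = begin
    (x - 1#) * (1# + x * geometric x n)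
      ≈⟨ solve 2 (λ x g → (x :- :1) :* (:1 :+ x :* g) := x :- :1 :+ x :* ((x :- :1) :* g)) refl x (geometric x n) ⟩
    x - 1# + x * ((x - 1#) * geometric x n)
      ≈⟨ +-congˡ (*-congˡ (geometric-telescopes x n)) ⟩
    x - 1# + x * (x ^ n - 1#)
      ≈⟨ solve 2 (λ x p → x :- :1 :+ x :* (p :- :1) := x :* p :- :1) refl x (x ^ n) ⟩
    x ^ suc n - 1# ∎

  ⟦1+n⟧ : ∀ n → ⟦ ℤ.+ suc n ⟧ ≈ 1# + ⟦ ℤ.+ n ⟧
  ⟦1+n⟧ n = trans (+-homo 1ℤ (ℤ.+ n)) (+-congʳ 1-homo)

  -- Modulo x - 1 each of the n powers of x is 1. This is the source of the nonzero integers in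
  -- comaximality relations.
  geometric≡n : ∀ x n → ∃[ z ] geometric x n ≈ ⟦ ℤ.+ n ⟧ + (x - 1#) * z
  geometric≡n x zero = 0# , sym (trans (+-cong 0-homo (zeroʳ _)) (+-identityˡ _))
  geometric≡n x (suc n) with geometric≡n x n
  ... | z , e = geometric x n + z , (begin
    1# + x * geometric x n
      ≈⟨ solve 2 (λ x g → :1 :+ x :* g := :1 :+ g :+ (x :- :1) :* g) refl x (geometric x n) ⟩
    1# + geometric x n + (x - 1#) * geometric x n
      ≈⟨ +-congʳ (+-congˡ e) ⟩
    1# + (⟦ ℤ.+ n ⟧ + (x - 1#) * z) + (x - 1#) * geometric x n
      ≈⟨ solve 4 (λ x g z c → :1 :+ (c :+ (x :- :1) :* z) :+ (x :- :1) :* g := (:1 :+ c) :+ (x :- :1) :* (g :+ z)) refl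
           x (geometric x n) z ⟦ ℤ.+ n ⟧ ⟩
    (1# + ⟦ ℤ.+ n ⟧) + (x - 1#) * (geometric x n + z)
      ≈⟨ +-congʳ (sym (⟦1+n⟧ n)) ⟩
    ⟦ ℤ.+ suc n ⟧ + (x - 1#) * (geometric x n + z) ∎)

  x^m-1∣x^mn-1 : ∀ x m n → x ^ m - 1# ∣ x ^ (m ℕ.* n) - 1#
  x^m-1∣x^mn-1 x m n = geometric (x ^ m) n ,
    trans (*-comm _ _) (trans (geometric-telescopes (x ^ m) n) (+-congʳ (^-assocʳ x m n)))

  x^m-1∣x^n-1 : ∀ x {m n} → m ℕ∣.∣ n → x ^ m - 1# ∣ x ^ n - 1#
  x^m-1∣x^n-1 x {m} (ℕ∣.divides k n≡k*m) = ∣-resp refl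
    (reflexive (≡.cong (λ n → x ^ n - 1#) (≡.trans (ℕ.*-comm m k) (≡.sym n≡k*m)))) (x^m-1∣x^mn-1 x m k)

  -- Bézout's identity in the exponents, in subtraction-free form: (x^(im) - 1) - x^g (x^(jn) - 1) =
  -- x^g - 1.
  x^g-1-combination : ∀ x g {m n} i j → g ℕ.+ j ℕ.* n ≡ i ℕ.* m →
    ∃[ a ] ∃[ b ] a * (x ^ m - 1#) + b * (x ^ n - 1#) ≈ x ^ g - 1#
  x^g-1-combination x g {m} {n} i j e with x^m-1∣x^n-1 x {m} {i ℕ.* m} (ℕ∣.n∣m*n i) | x^m-1∣x^n-1 x {n} {j ℕ.* n} (ℕ∣.n∣m*n j)
  ... | c , c≈ | d , d≈ = c , - (x ^ g * d) , (begin
    c * (x ^ m - 1#) + - (x ^ g * d) * (x ^ n - 1#)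
      ≈⟨ +-congˡ (solve 3 (λ g d n → :- (g :* d) :* n := :- (g :* (d :* n))) refl (x ^ g) d (x ^ n - 1#)) ⟩
    c * (x ^ m - 1#) - x ^ g * (d * (x ^ n - 1#))
      ≈⟨ +-cong c≈ (-‿cong (*-congˡ d≈)) ⟩
    (x ^ (i ℕ.* m) - 1#) - x ^ g * (x ^ (j ℕ.* n) - 1#)
      ≈⟨ +-congʳ (+-congʳ (trans (reflexive (≡.cong (x ^_) (≡.sym e))) (^-homo-* x g (j ℕ.* n)))) ⟩
    (x ^ g * x ^ (j ℕ.* n) - 1#) - x ^ g * (x ^ (j ℕ.* n) - 1#)
      ≈⟨ solve 2 (λ g y → g :* y :- :1 :- g :* (y :- :1) := g :- :1) refl (x ^ g) (x ^ (j ℕ.* n)) ⟩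
    x ^ g - 1# ∎)

  x^gcd-1 : ∀ x m n → ∃[ a ] ∃[ b ] a * (x ^ m - 1#) + b * (x ^ n - 1#) ≈ x ^ gcd m n - 1#
  x^gcd-1 x m n = go (Bézout.identity (gcd-GCD m n))
    where
    go : Bézout.Identity (gcd m n) m n → ∃[ a ] ∃[ b ] a * (x ^ m - 1#) + b * (x ^ n - 1#) ≈ x ^ gcd m n - 1#
    go (Bézout.+- i j e) = x^g-1-combination x (gcd m n) i j e
    go (Bézout.-+ i j e) =
      let b , a , e′ = x^g-1-combination x (gcd m n) j i e
      in a , b , trans (+-comm _ _) e′

  -- Phrased through multiples instead of coefficients, so that it passes to products and divisors
  -- without Gauss's lemma. The instance `M` = 0 makes `f` a non-zero-divisor.
  Primitive : Carrier → Set
  Primitive f = ∀ M z → ⟦ M ⟧ ∣ f * z → ⟦ M ⟧ ∣ z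

  Primitive-resp : ∀ {f g} → f ≈ g → Primitive f → Primitive g
  Primitive-resp f≈g pf M z d = pf M z (∣-resp refl (*-congʳ (sym f≈g)) d)

  Primitive-∣ : ∀ {f g} → f ∣ g → Primitive g → Primitive f
  Primitive-∣ {f} (c , e) pg M z d = pg M z
    (∣-resp refl (trans (sym (*-assoc c f z)) (*-congʳ e)) (∣n⇒∣m*n c d))

  Primitive-1 : Primitive 1#
  Primitive-1 M z = ∣-resp refl (*-identityˡ z)

  Primitive-* : ∀ {f g} → Primitive f → Primitive g → Primitive (f * g)
  Primitive-* pf pg M z d = pg M z (pf M _ (∣-resp refl (*-assoc _ _ _) d))

  -- f and g generate, after inverting the nonzero integers, the unit ideal.
  Comaximal : Carrier → Carrier → Set
  Comaximal f g = ∃[ M ] ∃[ a ] ∃[ b ] M ≢ 0ℤ × a * f + b * g ≈ ⟦ M ⟧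

  Comaximal-sym : ∀ {f g} → Comaximal f g → Comaximal g f
  Comaximal-sym (M , a , b , M≢0 , e) = M , b , a , M≢0 , trans (+-comm _ _) e

  Comaximal-∣ : ∀ {f g h} → g ∣ h → Comaximal f h → Comaximal f g
  Comaximal-∣ (c , ch) (M , a , b , M≢0 , e) =
    M , a , b * c , M≢0 , trans (+-congˡ (trans (*-assoc _ _ _) (*-congˡ ch))) e

  -- That is, `g` is a non-zero-divisor modulo `f`.
  Cancellable[_] : Carrier → Carrier → Set
  Cancellable[ f ] g = ∀ x → f ∣ x * g → f ∣ x

  Cancellable-1 : ∀ {f} → Cancellable[ f ] 1#
  Cancellable-1 x = ∣-resp refl (*-identityʳ x)

  Cancellable-* : ∀ {f g h} → Cancellable[ f ] g → Cancellable[ f ] h → Cancellable[ f ] (g * h)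
  Cancellable-* cg ch x d = cg x (ch _ (∣-resp refl (sym (*-assoc _ _ _)) d))

  Cancellable-resp : ∀ {f g h} → g ≈ h → Cancellable[ f ] g → Cancellable[ f ] h
  Cancellable-resp g≈h cg x d = cg x (∣-resp refl (*-congˡ (sym g≈h)) d)

  Torsionfree : Set
  Torsionfree = ∀ M x y → M ≢ 0ℤ → ⟦ M ⟧ * x ≈ ⟦ M ⟧ * y → x ≈ y

  -- In c f = x M primitivity of `f` makes c a multiple of M, and then M cancels from the equation.
  ⟦M⟧-cancellable : Torsionfree → ∀ {f} → Primitive f → ∀ M → M ≢ 0ℤ → Cancellable[ f ] ⟦ M ⟧
  ⟦M⟧-cancellable tf {f} pf M M≢0 x (c , e) with pf M c (x , trans (sym e) (*-comm c f))
  ... | c′ , e′ = c′ , tf M _ _ M≢0 (begin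
    ⟦ M ⟧ * (c′ * f)  ≈⟨ solve 3 (λ m c f → m :* (c :* f) := c :* m :* f) refl ⟦ M ⟧ c′ f ⟩
    c′ * ⟦ M ⟧ * f    ≈⟨ *-congʳ e′ ⟩
    c * f             ≈⟨ e ⟩
    x * ⟦ M ⟧         ≈⟨ *-comm _ _ ⟩
    ⟦ M ⟧ * x         ∎)

  -- Multiplying a f + b g = M by x shows that f divides x M, and the integer M can be cancelled.
  comaximal⇒cancellable : Torsionfree → ∀ {f g} → Primitive f → Comaximal f g → Cancellable[ f ] g
  comaximal⇒cancellable tf {f} {g} pf (M , a , b , M≢0 , e) x (c , d) =
    ⟦M⟧-cancellable tf pf M M≢0 x (a * x + b * c , (begin
      (a * x + b * c) * f          ≈⟨ solve 5 (λ a x b c f → (a :* x :+ b :* c) :* f := x :* (a :* f) :+ b :* (c :* f)) refl a x b c f ⟩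
      x * (a * f) + b * (c * f)    ≈⟨ +-congˡ (*-congˡ d) ⟩
      x * (a * f) + b * (x * g)    ≈⟨ solve 5 (λ a x b f g → x :* (a :* f) :+ b :* (x :* g) := x :* (a :* f :+ b :* g)) refl a x b f g ⟩
      x * (a * f + b * g)          ≈⟨ *-congˡ e ⟩
      x * ⟦ M ⟧                    ∎))

  ∣-neg : ∀ {x y} → x ∣ y → x ∣ - y
  ∣-neg {x} {y} (c , e) = - c , trans (solve 2 (λ c x → :- c :* x := :- (c :* x)) refl c x) (-‿cong e)

  Primitive-neg : ∀ {f} → Primitive f → Primitive (- f)
  Primitive-neg {f} pf M z d = pf M z
    (∣-resp refl (solve 2 (λ f z → :- (:- f :* z) := f :* z) refl f z) (∣-neg d))

  Cancellable-neg : ∀ {f g} → Cancellable[ f ] g → Cancellable[ f ] (- g)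
  Cancellable-neg {f} {g} cg x d = cg x
    (∣-resp refl (solve 2 (λ x g → :- (x :* :- g) := x :* g) refl x g) (∣-neg d))

  Cancellable-unit : ∀ {f} u v → f ∣ u * v - 1# → Cancellable[ f ] u
  Cancellable-unit {f} u v uv≡1 x d = ∣-resp refl
    (solve 3 (λ x u v → v :* (x :* u) :+ :- x :* (u :* v :- :1) := x) refl x u v)
    (∣m∣n⇒∣m+n (∣n⇒∣m*n v d) (∣n⇒∣m*n (- x) uv≡1))

  open Algebra.Properties.CommutativeMonoid.Sum +-commutativeMonoid public
    using (sum; ∑-distrib-+; sum-permute; sum-cong-≋; sum-replicate-zero)

  antisymmetric-sum : ∀ {n} (α : Fin n → Carrier) → (∀ i → α i + α (opposite i) ≈ 0#) → sum α + sum α ≈ 0#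
  antisymmetric-sum {n} α α+α≈0 = begin
    sum α + sum α                       ≈⟨ +-congˡ (sum-permute α Permutation.reverse) ⟩
    sum α + sum (λ i → α (opposite i))  ≈⟨ sym (∑-distrib-+ α (λ i → α (opposite i))) ⟩
    sum (λ i → α i + α (opposite i))    ≈⟨ sum-cong-≋ α+α≈0 ⟩
    sum {n} (λ i → 0#)                  ≈⟨ sum-replicate-zero n ⟩
    0#                                  ∎

  -- Addition of the fractions x/B = a/b and y/B = c/d, with all denominators cleared.
  fraction-+ : ∀ {a b c d x y} B → b * x ≈ a * B → d * y ≈ c * B → b * d * (x + y) ≈ (a * d + c * b) * B
  fraction-+ {a} {b} {c} {d} {x} {y} B e f = begin
    b * d * (x + y)                ≈⟨ solve 4 (λ b d x y → b :* d :* (x :+ y) := b :* x :* d :+ d :* y :* b) refl b d x y ⟩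
    b * x * d + d * y * b          ≈⟨ +-cong (*-congʳ e) (*-congʳ f) ⟩
    a * B * d + c * B * b          ≈⟨ solve 5 (λ a B d c b → a :* B :* d :+ c :* B :* b := (a :* d :+ c :* b) :* B) refl a B d c b ⟩
    (a * d + c * b) * B            ∎

  opposite-fractions : ∀ {a b c d x y} B → b * x ≈ a * B → d * y ≈ c * B → a * d + c * b ≈ 0# → (x + y) * (b * d) ≈ 0#
  opposite-fractions {b = b} {d = d} {x} {y} B e f ad+cb≈0 = trans (*-comm (x + y) (b * d))
    (trans (fraction-+ B e f) (trans (*-congʳ ad+cb≈0) (zeroˡ B)))

-- Quotient by a principal ideal

module _ (R : CommutativeRing 0ℓ 0ℓ) (ι : ℤ-Algebra R) where
  open Algebraic R ι

  -- A record, so that `x` and `y` can be inferred from the type instead of dissolving into an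
  -- existential statement about `x - y`.
  record Congruent (f x y : Carrier) : Set where
    constructor congruent
    field f∣x-y : f ∣ x - y

  module _ (f : Carrier) where
    private
      infix 4 _~_
      _~_ = Congruent f

      lift : ∀ {x y} → x ≈ y → x ~ y
      lift {x} {y} e = congruent (0# , trans (zeroˡ f) (sym (trans (+-congʳ e) (x-x≈0 y))))

      ~-sym : ∀ {x y} → x ~ y → y ~ x
      ~-sym {x} {y} (congruent (c , e)) = congruent (- c ,
        trans (solve 2 (λ c f → :- c :* f := :- (c :* f)) refl c f)
          (trans (-‿cong e) (solve 2 (λ x y → :- (x :- y) := y :- x) refl x y)))

      ~-trans : ∀ {x y z} → x ~ y → y ~ z → x ~ z
      ~-trans {x} {y} {z} (congruent p) (congruent q) = congruent (∣-resp refl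
        (solve 3 (λ x y z → x :- y :+ (y :- z) := x :- z) refl x y z) (∣m∣n⇒∣m+n p q))

      ~-+-cong : ∀ {x y u v} → x ~ y → u ~ v → x + u ~ y + v
      ~-+-cong {x} {y} {u} {v} (congruent p) (congruent q) = congruent (∣-resp refl
        (solve 4 (λ x y u v → x :- y :+ (u :- v) := x :+ u :- (y :+ v)) refl x y u v) (∣m∣n⇒∣m+n p q))

      ~-*-cong : ∀ {x y u v} → x ~ y → u ~ v → x * u ~ y * v
      ~-*-cong {x} {y} {u} {v} (congruent p) (congruent q) = congruent (∣-resp refl
        (solve 4 (λ x y u v → u :* (x :- y) :+ y :* (u :- v) := x :* u :- y :* v) refl x y u v)
        (∣m∣n⇒∣m+n (∣n⇒∣m*n u p) (∣n⇒∣m*n y q)))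

      ~-neg-cong : ∀ {x y} → x ~ y → - x ~ - y
      ~-neg-cong {x} {y} p with ~-sym p
      ... | congruent q = congruent (∣-resp refl (solve 2 (λ x y → y :- x := :- x :- :- y) refl x y) q)

    ≈⇒congruent : ∀ {x y} → x ≈ y → Congruent f x y
    ≈⇒congruent = lift

    -- Opaque, since conversion checking would otherwise unfold the ring solver proofs.
    abstract
      quotient-isCommutativeRing : IsCommutativeRing _~_ _+_ _*_ -_ 0# 1#
      quotient-isCommutativeRing = record
        { isRing = record
          { +-isAbelianGroup = record
            { isGroup = record
              { isMonoid = record
                { isSemigroup = record
                  { isMagma = record
                    { isEquivalence = record { refl = lift refl ; sym = ~-sym ; trans = ~-trans }
                    ; ∙-cong = ~-+-cong
                    }
                  ; assoc = λ x y z → lift (+-assoc x y z)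
                  }
                ; identity = (λ x → lift (+-identityˡ x)) , (λ x → lift (+-identityʳ x))
                }
              ; inverse = (λ x → lift (-‿inverseˡ x)) , (λ x → lift (-‿inverseʳ x))
              ; ⁻¹-cong = ~-neg-cong
              }
            ; comm = λ x y → lift (+-comm x y)
            }
          ; *-cong = ~-*-cong
          ; *-assoc = λ x y z → lift (*-assoc x y z)
          ; *-identity = (λ x → lift (*-identityˡ x)) , (λ x → lift (*-identityʳ x))
          ; distrib = (λ x y z → lift (distribˡ x y z)) , (λ x y z → lift (distribʳ x y z))
          }
        ; *-comm = λ x y → lift (*-comm x y)
        }

    quotientRing : CommutativeRing 0ℓ 0ℓ
    quotientRing = record
      { Carrier = Carrier ; _≈_ = _~_ ; _+_ = _+_ ; _*_ = _*_ ; -_ = -_ ; 0# = 0# ; 1# = 1#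
      ; isCommutativeRing = quotient-isCommutativeRing
      }

    quotientAlgebra : ℤ-Algebra quotientRing
    quotientAlgebra = record
      { ⟦_⟧    = ⟦_⟧
      ; +-homo = λ x y → lift (+-homo x y)
      ; *-homo = λ x y → lift (*-homo x y)
      ; -‿homo = λ x → lift (-‿homo x)
      ; 0-homo = lift 0-homo
      ; 1-homo = lift 1-homo
      }

-- Cancellation of opposite terms when q^n = 1 and [n] = 0

module _ (R : CommutativeRing 0ℓ 0ℓ) (ι : ℤ-Algebra R) where
  open Algebraic R ι

  module RootOfUnity (q : Carrier) (m : ℕ)
    (q^n≈1 : q ^ (1 ℕ.+ 3 ℕ.* m) ≈ 1#) (geometric≈0 : geometric q (1 ℕ.+ 3 ℕ.* m) ≈ 0#) where

    private
      n = 1 ℕ.+ 3 ℕ.* m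

    q^[n*k]≈1 : ∀ k → q ^ (n ℕ.* k) ≈ 1#
    q^[n*k]≈1 k = trans (sym (^-assocʳ q n k)) (trans (^-congˡ k q^n≈1) (1^ k))

    q^-periodic : ∀ a s → q ^ (a ℕ.+ n ℕ.* s) ≈ q ^ a
    q^-periodic a s = trans (^-homo-* q a (n ℕ.* s)) (trans (*-congˡ (q^[n*k]≈1 s)) (*-identityʳ _))

    -- Congruence of exponents modulo n, with a multiple of n on either side in order to stay in ℕ.
    q^-cong : ∀ {a b} s t → a ℕ.+ n ℕ.* s ≡ b ℕ.+ n ℕ.* t → q ^ a ≈ q ^ b
    q^-cong {a} {b} s t e = trans (sym (q^-periodic a s)) (trans (reflexive (≡.cong (q ^_) e)) (q^-periodic b t))

    pochhammer : ℕ → ℕ → Carrier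
    pochhammer a zero    = 1#
    pochhammer a (suc k) = pochhammer a k * (1# - q ^ (a ℕ.+ 3 ℕ.* k))

    sign : ℕ → ℕ → Carrier
    sign a zero    = 1#
    sign a (suc k) = sign a k * (- q ^ (a ℕ.+ 3 ℕ.* k))

    -- If x y = 1 then 1 - x = -x (1 - y); with x = q^(a+3i), y = q^(3+3j) this trades a factor
    -- of the first product for one of the second.
    pochhammer-reflect : ∀ a i j → q ^ (a ℕ.+ 3 ℕ.* (i ℕ.+ j)) ≈ 1# →
      pochhammer a i * pochhammer 3 j ≈ sign a i * pochhammer 3 (i ℕ.+ j)
    pochhammer-reflect a zero    j e = refl
    pochhammer-reflect a (suc i) j e = begin
      U * (1# - x) * V
        ≈⟨ *-congʳ (*-congˡ (+-congʳ (sym xy≈1))) ⟩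
      U * (x * y - x) * V
        ≈⟨ solve 4 (λ U V x y → U :* (x :* y :- x) :* V := (:- x) :* (U :* (V :* (:1 :- y)))) refl U V x y ⟩
      (- x) * (U * (V * (1# - y)))
        ≈⟨ *-congˡ (pochhammer-reflect a i (suc j) (trans (reflexive (≡.cong (λ t → q ^ (a ℕ.+ 3 ℕ.* t)) (ℕ.+-suc i j))) e)) ⟩
      (- x) * (sign a i * pochhammer 3 (i ℕ.+ suc j))
        ≈⟨ *-congˡ (*-congˡ (reflexive (≡.cong (pochhammer 3) (ℕ.+-suc i j)))) ⟩
      (- x) * (sign a i * pochhammer 3 (suc i ℕ.+ j))
        ≈⟨ solve 3 (λ x E P → (:- x) :* (E :* P) := E :* (:- x) :* P) refl x (sign a i) (pochhammer 3 (suc i ℕ.+ j)) ⟩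
      sign a i * (- x) * pochhammer 3 (suc i ℕ.+ j) ∎
      where
      U = pochhammer a i
      V = pochhammer 3 j
      x = q ^ (a ℕ.+ 3 ℕ.* i)
      y = q ^ (3 ℕ.+ 3 ℕ.* j)
      exponent : ∀ a i j → a ℕ.+ 3 ℕ.* i ℕ.+ (3 ℕ.+ 3 ℕ.* j) ≡ a ℕ.+ 3 ℕ.* (suc i ℕ.+ j)
      exponent = solve-∀
      xy≈1 : x * y ≈ 1#
      xy≈1 = trans (sym (^-homo-* q (a ℕ.+ 3 ℕ.* i) (3 ℕ.+ 3 ℕ.* j)))
        (trans (reflexive (≡.cong (q ^_) (exponent a i j))) e)

    -- The number 3k² - k, given by a recursion that avoids subtraction.
    gₖ : ℕ → ℕ
    gₖ zero    = 0
    gₖ (suc k) = gₖ k ℕ.+ ((1 ℕ.+ 3 ℕ.* k) ℕ.+ (1 ℕ.+ 3 ℕ.* k))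

    gₖ+k : ∀ k → gₖ k ℕ.+ k ≡ 3 ℕ.* (k ℕ.* k)
    gₖ+k zero    = ≡.refl
    gₖ+k (suc k) = ≡.trans (regroup (gₖ k) k) (≡.trans (≡.cong (ℕ._+ (3 ℕ.+ 6 ℕ.* k)) (gₖ+k k)) (square k))
      where
      regroup : ∀ g k → g ℕ.+ ((1 ℕ.+ 3 ℕ.* k) ℕ.+ (1 ℕ.+ 3 ℕ.* k)) ℕ.+ suc k ≡ g ℕ.+ k ℕ.+ (3 ℕ.+ 6 ℕ.* k)
      regroup = solve-∀
      square : ∀ k → 3 ℕ.* (k ℕ.* k) ℕ.+ (3 ℕ.+ 6 ℕ.* k) ≡ 3 ℕ.* (suc k ℕ.* suc k)
      square = solve-∀

    -- The square suffices because these Pochhammer symbols occur only to even powers 2h; it leaves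
    -- a pure power of q.
    sign₁² : ∀ k → sign 1 k ^ 2 ≈ q ^ gₖ k
    sign₁² zero    = 1^ 2
    sign₁² (suc k) = begin
      (sign 1 k * (- x)) ^ 2
        ≈⟨ solve 2 (λ E x → (E :* (:- x)) :^ 2 := E :^ 2 :* (x :* x)) refl (sign 1 k) x ⟩
      sign 1 k ^ 2 * (x * x)
        ≈⟨ *-cong (sign₁² k) (sym (^-homo-* q e e)) ⟩
      q ^ gₖ k * q ^ (e ℕ.+ e)
        ≈⟨ sym (^-homo-* q (gₖ k) (e ℕ.+ e)) ⟩
      q ^ gₖ (suc k) ∎
      where
      e = 1 ℕ.+ 3 ℕ.* k
      x = q ^ e

    -- The number of factors is even, so the signs cancel, and the exponents 2 + 3j for j < 2l add
    -- up to 6l² + l.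
    sign₂-even : ∀ l → sign 2 (2 ℕ.* l) ≈ q ^ (l ℕ.* (6 ℕ.* l ℕ.+ 1))
    sign₂-even zero    = refl
    sign₂-even (suc l) = begin
      sign 2 (2 ℕ.* suc l)
        ≈⟨ reflexive (≡.cong (sign 2) (ℕ.*-suc 2 l)) ⟩
      sign 2 (2 ℕ.* l) * (- q ^ e) * (- q ^ e′)
        ≈⟨ solve 3 (λ E x y → E :* (:- x) :* (:- y) := E :* (x :* y)) refl (sign 2 (2 ℕ.* l)) (q ^ e) (q ^ e′) ⟩
      sign 2 (2 ℕ.* l) * (q ^ e * q ^ e′)
        ≈⟨ *-cong (sign₂-even l) (sym (^-homo-* q e e′)) ⟩
      q ^ (l ℕ.* (6 ℕ.* l ℕ.+ 1)) * q ^ (e ℕ.+ e′)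
        ≈⟨ sym (^-homo-* q (l ℕ.* (6 ℕ.* l ℕ.+ 1)) (e ℕ.+ e′)) ⟩
      q ^ (l ℕ.* (6 ℕ.* l ℕ.+ 1) ℕ.+ (e ℕ.+ e′))
        ≈⟨ reflexive (≡.cong (q ^_) (exponent l)) ⟩
      q ^ (suc l ℕ.* (6 ℕ.* suc l ℕ.+ 1)) ∎
      where
      e = 2 ℕ.+ 3 ℕ.* (2 ℕ.* l)
      e′ = 2 ℕ.+ 3 ℕ.* suc (2 ℕ.* l)
      exponent : ∀ l → l ℕ.* (6 ℕ.* l ℕ.+ 1) ℕ.+ ((2 ℕ.+ 3 ℕ.* (2 ℕ.* l)) ℕ.+ (2 ℕ.+ 3 ℕ.* suc (2 ℕ.* l)))
                 ≡ suc l ℕ.* (6 ℕ.* suc l ℕ.+ 1)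
      exponent = solve-∀

    -- The three sums are the cases (3,2,0), (2,0,0) and (1,0,2): 2h is the exponent of the
    -- Pochhammer symbols, `c` and `d` give the extra powers of q above and below the fraction bar.
    module Terms (h c d : ℕ) where
      numerator denominator : ℕ → Carrier
      numerator k   = geometric q (6 ℕ.* k ℕ.+ 1) * pochhammer 1 k ^ (2 ℕ.* h) * pochhammer 3 (2 ℕ.* k) * q ^ (c ℕ.* k)
      denominator k = pochhammer 3 k ^ (2 ℕ.* h) * pochhammer 2 (2 ℕ.* k) * q ^ (d ℕ.* k)

      exponent : ℕ → ℕ → ℕ
      exponent k l = gₖ k ℕ.* h ℕ.+ l ℕ.* (6 ℕ.* l ℕ.+ 1) ℕ.+ (c ℕ.* k ℕ.+ d ℕ.* l)

      common : Carrier
      common = pochhammer 3 m ^ (2 ℕ.* h) * pochhammer 3 (2 ℕ.* m)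

      -- Cross-multiplied, because reflection always pairs a factor of the numerator at `k` with a
      -- factor of the denominator at `l`; no inverse is required.
      numerator*denominator : ∀ k l → k ℕ.+ l ≡ m →
        numerator k * denominator l ≈ geometric q (6 ℕ.* k ℕ.+ 1) * q ^ exponent k l * common
      numerator*denominator k l k+l≡m = begin
        G * P ^ e * W * X * (V ^ e * Z * Y)
          ≈⟨ solve 7 (λ G P W X V Z Y → G :* P :* W :* X :* (V :* Z :* Y) := G :* (P :* V) :* (Z :* W) :* (X :* Y)) refl
               G (P ^ e) W X (V ^ e) Z Y ⟩
        G * (P ^ e * V ^ e) * (Z * W) * (X * Y)
          ≈⟨ *-cong (*-cong (*-congˡ first) second) (sym (^-homo-* q (c ℕ.* k) (d ℕ.* l))) ⟩
        G * (q ^ (gₖ k ℕ.* h) * pochhammer 3 m ^ e) * (q ^ (l ℕ.* (6 ℕ.* l ℕ.+ 1)) * pochhammer 3 (2 ℕ.* m)) * q ^ (c ℕ.* k ℕ.+ d ℕ.* l)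
          ≈⟨ solve 6 (λ G A P B Q C → G :* (A :* P) :* (B :* Q) :* C := G :* (A :* B :* C) :* (P :* Q)) refl
               G (q ^ (gₖ k ℕ.* h)) (pochhammer 3 m ^ e) (q ^ (l ℕ.* (6 ℕ.* l ℕ.+ 1))) (pochhammer 3 (2 ℕ.* m)) (q ^ (c ℕ.* k ℕ.+ d ℕ.* l)) ⟩
        G * (q ^ (gₖ k ℕ.* h) * q ^ (l ℕ.* (6 ℕ.* l ℕ.+ 1)) * q ^ (c ℕ.* k ℕ.+ d ℕ.* l)) * common
          ≈⟨ *-congʳ (*-congˡ (trans (*-congʳ (sym (^-homo-* q (gₖ k ℕ.* h) (l ℕ.* (6 ℕ.* l ℕ.+ 1))))) (sym (^-homo-* q (gₖ k ℕ.* h ℕ.+ l ℕ.* (6 ℕ.* l ℕ.+ 1)) (c ℕ.* k ℕ.+ d ℕ.* l))))) ⟩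
        G * q ^ exponent k l * common ∎
        where
        e = 2 ℕ.* h
        G = geometric q (6 ℕ.* k ℕ.+ 1)
        P = pochhammer 1 k
        W = pochhammer 3 (2 ℕ.* k)
        X = q ^ (c ℕ.* k)
        V = pochhammer 3 l
        Z = pochhammer 2 (2 ℕ.* l)
        Y = q ^ (d ℕ.* l)
        double : 2 ℕ.* l ℕ.+ 2 ℕ.* k ≡ 2 ℕ.* m
        double = ≡.trans (≡.sym (ℕ.*-distribˡ-+ 2 l k)) (≡.cong (2 ℕ.*_) (≡.trans (ℕ.+-comm l k) k+l≡m))
        first : P ^ e * V ^ e ≈ q ^ (gₖ k ℕ.* h) * pochhammer 3 m ^ e
        first = begin
          P ^ e * V ^ e
            ≈⟨ sym (^-distrib-* P V e) ⟩
          (P * V) ^ e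
            ≈⟨ ^-congˡ e (pochhammer-reflect 1 k l (trans (reflexive (≡.cong (λ t → q ^ (1 ℕ.+ 3 ℕ.* t)) k+l≡m)) q^n≈1)) ⟩
          (sign 1 k * pochhammer 3 (k ℕ.+ l)) ^ e
            ≈⟨ ^-distrib-* _ _ e ⟩
          sign 1 k ^ e * pochhammer 3 (k ℕ.+ l) ^ e
            ≈⟨ *-cong (trans (sym (^-assocʳ (sign 1 k) 2 h)) (trans (^-congˡ h (sign₁² k)) (^-assocʳ q (gₖ k) h)))
                      (reflexive (≡.cong (λ t → pochhammer 3 t ^ e) k+l≡m)) ⟩
          q ^ (gₖ k ℕ.* h) * pochhammer 3 m ^ e ∎
        twice : ∀ m → 2 ℕ.+ 3 ℕ.* (2 ℕ.* m) ≡ (1 ℕ.+ 3 ℕ.* m) ℕ.* 2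
        twice = solve-∀
        second : Z * W ≈ q ^ (l ℕ.* (6 ℕ.* l ℕ.+ 1)) * pochhammer 3 (2 ℕ.* m)
        second = trans
          (pochhammer-reflect 2 (2 ℕ.* l) (2 ℕ.* k)
            (trans (reflexive (≡.cong (q ^_) (≡.trans (≡.cong (λ t → 2 ℕ.+ 3 ℕ.* t) double) (twice m)))) (q^[n*k]≈1 2)))
          (*-cong (sign₂-even l) (reflexive (≡.cong (pochhammer 3) double)))

      -- A congruence modulo n: the two powers of q differ by exactly the factor q^(6k+1) that joins
      -- [6k+1] and [6l+1] into [2n].
      Antisymmetric : Set
      Antisymmetric = ∀ k l → k ℕ.+ l ≡ m →
        ∃[ s ] ∃[ t ] exponent k l ℕ.+ (6 ℕ.* k ℕ.+ 1) ℕ.+ n ℕ.* s ≡ exponent l k ℕ.+ n ℕ.* t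

      terms-cancel : Antisymmetric → ∀ k l → k ℕ.+ l ≡ m →
        numerator k * denominator l + numerator l * denominator k ≈ 0#
      terms-cancel antisymmetric k l k+l≡m with antisymmetric k l k+l≡m
      ... | s , t , exponents = begin
        numerator k * denominator l + numerator l * denominator k
          ≈⟨ +-cong (numerator*denominator k l k+l≡m)
                    (numerator*denominator l k (≡.trans (ℕ.+-comm l k) k+l≡m)) ⟩
        G k * q ^ exponent k l * common + G l * q ^ exponent l k * common
          ≈⟨ +-congˡ (*-congʳ (*-congˡ (sym (trans (sym (^-homo-* q (exponent k l) (6 ℕ.* k ℕ.+ 1))) (q^-cong {exponent k l ℕ.+ (6 ℕ.* k ℕ.+ 1)} {exponent l k} s t exponents))))) ⟩
        G k * q ^ exponent k l * common + G l * (q ^ exponent k l * q ^ (6 ℕ.* k ℕ.+ 1)) * common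
          ≈⟨ solve 5 (λ K L F Q C → K :* F :* C :+ L :* (F :* Q) :* C := (K :+ Q :* L) :* (F :* C)) refl
               (G k) (G l) (q ^ exponent k l) (q ^ (6 ℕ.* k ℕ.+ 1)) common ⟩
        (G k + q ^ (6 ℕ.* k ℕ.+ 1) * G l) * (q ^ exponent k l * common)
          ≈⟨ *-congʳ (trans (sym (geometric-+ q (6 ℕ.* k ℕ.+ 1) (6 ℕ.* l ℕ.+ 1)))
               (trans (reflexive (≡.cong (geometric q) (≡.trans (twice k l) (≡.cong (λ t → (1 ℕ.+ 3 ℕ.* t) ℕ.+ (1 ℕ.+ 3 ℕ.* t)) k+l≡m))))
               (trans (geometric-+ q n n) (+-cong geometric≈0 (*-congˡ geometric≈0))))) ⟩
        (0# + q ^ n * 0#) * (q ^ exponent k l * common)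
          ≈⟨ *-congʳ (trans (+-identityˡ _) (zeroʳ _)) ⟩
        0# * (q ^ exponent k l * common)
          ≈⟨ zeroˡ _ ⟩
        0# ∎
        where
        G : ℕ → Carrier
        G k = geometric q (6 ℕ.* k ℕ.+ 1)
        twice : ∀ k l → 6 ℕ.* k ℕ.+ 1 ℕ.+ (6 ℕ.* l ℕ.+ 1) ≡ (1 ℕ.+ 3 ℕ.* (k ℕ.+ l)) ℕ.+ (1 ℕ.+ 3 ℕ.* (k ℕ.+ l))
        twice = solve-∀

    private
      -- Adding h (k + l) on both sides turns `gₖ k` and `gₖ l` into 3k² and 3l², and the remaining
      -- identity is polynomial in k and l.
      balance : ∀ h {A B} k l L R → A ℕ.+ (h ℕ.* k ℕ.+ h ℕ.* l) ≡ h ℕ.* (gₖ k ℕ.+ k) ℕ.+ L →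
        B ℕ.+ (h ℕ.* k ℕ.+ h ℕ.* l) ≡ h ℕ.* (gₖ l ℕ.+ l) ℕ.+ R →
        h ℕ.* (3 ℕ.* (k ℕ.* k)) ℕ.+ L ≡ h ℕ.* (3 ℕ.* (l ℕ.* l)) ℕ.+ R → A ≡ B
      balance h k l L R a b e = ℕ.+-cancelʳ-≡ (h ℕ.* k ℕ.+ h ℕ.* l) _ _
        (≡.trans a (≡.trans (≡.cong (λ x → h ℕ.* x ℕ.+ L) (gₖ+k k))
          (≡.trans e (≡.trans (≡.cong (λ x → h ℕ.* x ℕ.+ R) (≡.sym (gₖ+k l))) (≡.sym b)))))

    -- The exponents differ by (k - l + 1) n, whence the witnesses l and k + 1. In the two cases
    -- that follow, the differences are n and (l - k + 1) n.
    antisymmetric₁ : Terms.Antisymmetric 3 2 0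
    antisymmetric₁ k l ≡.refl = l , (k ℕ.+ 1) ,
      balance 3 k l
        (l ℕ.* (6 ℕ.* l ℕ.+ 1) ℕ.+ (2 ℕ.* k ℕ.+ 0 ℕ.* l) ℕ.+ (6 ℕ.* k ℕ.+ 1) ℕ.+ (1 ℕ.+ 3 ℕ.* (k ℕ.+ l)) ℕ.* l ℕ.+ 3 ℕ.* l)
        (k ℕ.* (6 ℕ.* k ℕ.+ 1) ℕ.+ (2 ℕ.* l ℕ.+ 0 ℕ.* k) ℕ.+ (1 ℕ.+ 3 ℕ.* (k ℕ.+ l)) ℕ.* (k ℕ.+ 1) ℕ.+ 3 ℕ.* k)
        (left (gₖ k) k l) (right (gₖ l) k l) (middle k l)
      where
      left : ∀ g k l → g ℕ.* 3 ℕ.+ l ℕ.* (6 ℕ.* l ℕ.+ 1) ℕ.+ (2 ℕ.* k ℕ.+ 0 ℕ.* l) ℕ.+ (6 ℕ.* k ℕ.+ 1) ℕ.+ (1 ℕ.+ 3 ℕ.* (k ℕ.+ l)) ℕ.* l ℕ.+ (3 ℕ.* k ℕ.+ 3 ℕ.* l)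
        ≡ 3 ℕ.* (g ℕ.+ k) ℕ.+ (l ℕ.* (6 ℕ.* l ℕ.+ 1) ℕ.+ (2 ℕ.* k ℕ.+ 0 ℕ.* l) ℕ.+ (6 ℕ.* k ℕ.+ 1) ℕ.+ (1 ℕ.+ 3 ℕ.* (k ℕ.+ l)) ℕ.* l ℕ.+ 3 ℕ.* l)
      left = solve-∀
      right : ∀ g k l → g ℕ.* 3 ℕ.+ k ℕ.* (6 ℕ.* k ℕ.+ 1) ℕ.+ (2 ℕ.* l ℕ.+ 0 ℕ.* k) ℕ.+ (1 ℕ.+ 3 ℕ.* (k ℕ.+ l)) ℕ.* (k ℕ.+ 1) ℕ.+ (3 ℕ.* k ℕ.+ 3 ℕ.* l)
        ≡ 3 ℕ.* (g ℕ.+ l) ℕ.+ (k ℕ.* (6 ℕ.* k ℕ.+ 1) ℕ.+ (2 ℕ.* l ℕ.+ 0 ℕ.* k) ℕ.+ (1 ℕ.+ 3 ℕ.* (k ℕ.+ l)) ℕ.* (k ℕ.+ 1) ℕ.+ 3 ℕ.* k)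
      right = solve-∀
      middle : ∀ k l → 3 ℕ.* (3 ℕ.* (k ℕ.* k)) ℕ.+ (l ℕ.* (6 ℕ.* l ℕ.+ 1) ℕ.+ (2 ℕ.* k ℕ.+ 0 ℕ.* l) ℕ.+ (6 ℕ.* k ℕ.+ 1) ℕ.+ (1 ℕ.+ 3 ℕ.* (k ℕ.+ l)) ℕ.* l ℕ.+ 3 ℕ.* l)
        ≡ 3 ℕ.* (3 ℕ.* (l ℕ.* l)) ℕ.+ (k ℕ.* (6 ℕ.* k ℕ.+ 1) ℕ.+ (2 ℕ.* l ℕ.+ 0 ℕ.* k) ℕ.+ (1 ℕ.+ 3 ℕ.* (k ℕ.+ l)) ℕ.* (k ℕ.+ 1) ℕ.+ 3 ℕ.* k)
      middle = solve-∀

    antisymmetric₂ : Terms.Antisymmetric 2 0 0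
    antisymmetric₂ k l ≡.refl = 0 , 1 ,
      balance 2 k l
        (l ℕ.* (6 ℕ.* l ℕ.+ 1) ℕ.+ (0 ℕ.* k ℕ.+ 0 ℕ.* l) ℕ.+ (6 ℕ.* k ℕ.+ 1) ℕ.+ (1 ℕ.+ 3 ℕ.* (k ℕ.+ l)) ℕ.* 0 ℕ.+ 2 ℕ.* l)
        (k ℕ.* (6 ℕ.* k ℕ.+ 1) ℕ.+ (0 ℕ.* l ℕ.+ 0 ℕ.* k) ℕ.+ (1 ℕ.+ 3 ℕ.* (k ℕ.+ l)) ℕ.* 1 ℕ.+ 2 ℕ.* k)
        (left (gₖ k) k l) (right (gₖ l) k l) (middle k l)
      where
      left : ∀ g k l → g ℕ.* 2 ℕ.+ l ℕ.* (6 ℕ.* l ℕ.+ 1) ℕ.+ (0 ℕ.* k ℕ.+ 0 ℕ.* l) ℕ.+ (6 ℕ.* k ℕ.+ 1) ℕ.+ (1 ℕ.+ 3 ℕ.* (k ℕ.+ l)) ℕ.* 0 ℕ.+ (2 ℕ.* k ℕ.+ 2 ℕ.* l)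
        ≡ 2 ℕ.* (g ℕ.+ k) ℕ.+ (l ℕ.* (6 ℕ.* l ℕ.+ 1) ℕ.+ (0 ℕ.* k ℕ.+ 0 ℕ.* l) ℕ.+ (6 ℕ.* k ℕ.+ 1) ℕ.+ (1 ℕ.+ 3 ℕ.* (k ℕ.+ l)) ℕ.* 0 ℕ.+ 2 ℕ.* l)
      left = solve-∀
      right : ∀ g k l → g ℕ.* 2 ℕ.+ k ℕ.* (6 ℕ.* k ℕ.+ 1) ℕ.+ (0 ℕ.* l ℕ.+ 0 ℕ.* k) ℕ.+ (1 ℕ.+ 3 ℕ.* (k ℕ.+ l)) ℕ.* 1 ℕ.+ (2 ℕ.* k ℕ.+ 2 ℕ.* l)
        ≡ 2 ℕ.* (g ℕ.+ l) ℕ.+ (k ℕ.* (6 ℕ.* k ℕ.+ 1) ℕ.+ (0 ℕ.* l ℕ.+ 0 ℕ.* k) ℕ.+ (1 ℕ.+ 3 ℕ.* (k ℕ.+ l)) ℕ.* 1 ℕ.+ 2 ℕ.* k)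
      right = solve-∀
      middle : ∀ k l → 2 ℕ.* (3 ℕ.* (k ℕ.* k)) ℕ.+ (l ℕ.* (6 ℕ.* l ℕ.+ 1) ℕ.+ (0 ℕ.* k ℕ.+ 0 ℕ.* l) ℕ.+ (6 ℕ.* k ℕ.+ 1) ℕ.+ (1 ℕ.+ 3 ℕ.* (k ℕ.+ l)) ℕ.* 0 ℕ.+ 2 ℕ.* l)
        ≡ 2 ℕ.* (3 ℕ.* (l ℕ.* l)) ℕ.+ (k ℕ.* (6 ℕ.* k ℕ.+ 1) ℕ.+ (0 ℕ.* l ℕ.+ 0 ℕ.* k) ℕ.+ (1 ℕ.+ 3 ℕ.* (k ℕ.+ l)) ℕ.* 1 ℕ.+ 2 ℕ.* k)
      middle = solve-∀

    antisymmetric₃ : Terms.Antisymmetric 1 0 2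
    antisymmetric₃ k l ≡.refl = k , (l ℕ.+ 1) ,
      balance 1 k l
        (l ℕ.* (6 ℕ.* l ℕ.+ 1) ℕ.+ (0 ℕ.* k ℕ.+ 2 ℕ.* l) ℕ.+ (6 ℕ.* k ℕ.+ 1) ℕ.+ (1 ℕ.+ 3 ℕ.* (k ℕ.+ l)) ℕ.* k ℕ.+ 1 ℕ.* l)
        (k ℕ.* (6 ℕ.* k ℕ.+ 1) ℕ.+ (0 ℕ.* l ℕ.+ 2 ℕ.* k) ℕ.+ (1 ℕ.+ 3 ℕ.* (k ℕ.+ l)) ℕ.* (l ℕ.+ 1) ℕ.+ 1 ℕ.* k)
        (left (gₖ k) k l) (right (gₖ l) k l) (middle k l)
      where
      left : ∀ g k l → g ℕ.* 1 ℕ.+ l ℕ.* (6 ℕ.* l ℕ.+ 1) ℕ.+ (0 ℕ.* k ℕ.+ 2 ℕ.* l) ℕ.+ (6 ℕ.* k ℕ.+ 1) ℕ.+ (1 ℕ.+ 3 ℕ.* (k ℕ.+ l)) ℕ.* k ℕ.+ (1 ℕ.* k ℕ.+ 1 ℕ.* l)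
        ≡ 1 ℕ.* (g ℕ.+ k) ℕ.+ (l ℕ.* (6 ℕ.* l ℕ.+ 1) ℕ.+ (0 ℕ.* k ℕ.+ 2 ℕ.* l) ℕ.+ (6 ℕ.* k ℕ.+ 1) ℕ.+ (1 ℕ.+ 3 ℕ.* (k ℕ.+ l)) ℕ.* k ℕ.+ 1 ℕ.* l)
      left = solve-∀
      right : ∀ g k l → g ℕ.* 1 ℕ.+ k ℕ.* (6 ℕ.* k ℕ.+ 1) ℕ.+ (0 ℕ.* l ℕ.+ 2 ℕ.* k) ℕ.+ (1 ℕ.+ 3 ℕ.* (k ℕ.+ l)) ℕ.* (l ℕ.+ 1) ℕ.+ (1 ℕ.* k ℕ.+ 1 ℕ.* l)
        ≡ 1 ℕ.* (g ℕ.+ l) ℕ.+ (k ℕ.* (6 ℕ.* k ℕ.+ 1) ℕ.+ (0 ℕ.* l ℕ.+ 2 ℕ.* k) ℕ.+ (1 ℕ.+ 3 ℕ.* (k ℕ.+ l)) ℕ.* (l ℕ.+ 1) ℕ.+ 1 ℕ.* k)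
      right = solve-∀
      middle : ∀ k l → 1 ℕ.* (3 ℕ.* (k ℕ.* k)) ℕ.+ (l ℕ.* (6 ℕ.* l ℕ.+ 1) ℕ.+ (0 ℕ.* k ℕ.+ 2 ℕ.* l) ℕ.+ (6 ℕ.* k ℕ.+ 1) ℕ.+ (1 ℕ.+ 3 ℕ.* (k ℕ.+ l)) ℕ.* k ℕ.+ 1 ℕ.* l)
        ≡ 1 ℕ.* (3 ℕ.* (l ℕ.* l)) ℕ.+ (k ℕ.* (6 ℕ.* k ℕ.+ 1) ℕ.+ (0 ℕ.* l ℕ.+ 2 ℕ.* k) ℕ.+ (1 ℕ.+ 3 ℕ.* (k ℕ.+ l)) ℕ.* (l ℕ.+ 1) ℕ.+ 1 ℕ.* k)
      middle = solve-∀

-- The ring ℤ[q]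

coeff : Poly → ℕ → ℤ
coeff []      i       = 0ℤ
coeff (a ∷ p) zero    = a
coeff (a ∷ p) (suc i) = coeff p i

infix 4 _≋_
-- Coefficientwise, so that lists differing by trailing zeros agree; equivalent to `_≈P_`, but free
-- of the computed difference.
record _≋_ (p q : Poly) : Set where
  constructor coeffwise
  field at : ∀ i → coeff p i ≡ coeff q i
open _≋_

scale : ℤ → Poly → Poly
scale a = map (a ℤ.*_)

coeff-+ : ∀ p q i → coeff (p +P q) i ≡ coeff p i ℤ.+ coeff q i
coeff-+ []      q       i       = ≡.sym (ℤ.+-identityˡ _)
coeff-+ (a ∷ p) []      i       = ≡.sym (ℤ.+-identityʳ _)
coeff-+ (a ∷ p) (b ∷ q) zero    = ≡.refl
coeff-+ (a ∷ p) (b ∷ q) (suc i) = coeff-+ p q i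

coeff-neg : ∀ p i → coeff (negP p) i ≡ ℤ.- coeff p i
coeff-neg []      i       = ≡.refl
coeff-neg (a ∷ p) zero    = ≡.refl
coeff-neg (a ∷ p) (suc i) = coeff-neg p i

coeff-scale : ∀ a p i → coeff (scale a p) i ≡ a ℤ.* coeff p i
coeff-scale a []      i       = ≡.sym (ℤ.*-zeroʳ a)
coeff-scale a (b ∷ p) zero    = ≡.refl
coeff-scale a (b ∷ p) (suc i) = coeff-scale a p i

IsZeroP⇒coeff≡0 : ∀ {p} → IsZeroP p → ∀ i → coeff p i ≡ 0ℤ
IsZeroP⇒coeff≡0 []       i       = ≡.refl
IsZeroP⇒coeff≡0 (z ∷ zs) zero    = z
IsZeroP⇒coeff≡0 (z ∷ zs) (suc i) = IsZeroP⇒coeff≡0 zs i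

coeff≡0⇒IsZeroP : ∀ p → (∀ i → coeff p i ≡ 0ℤ) → IsZeroP p
coeff≡0⇒IsZeroP []      z = []
coeff≡0⇒IsZeroP (a ∷ p) z = z 0 ∷ coeff≡0⇒IsZeroP p (λ i → z (suc i))

coeff-- : ∀ p q i → coeff (p -P q) i ≡ coeff p i ℤ.- coeff q i
coeff-- p q i = ≡.trans (coeff-+ p (negP q) i) (≡.cong (λ x → coeff p i ℤ.+ x) (coeff-neg q i))

≈P⇒≋ : ∀ {p q} → p ≈P q → p ≋ q
≈P⇒≋ {p} {q} z = coeffwise λ i →
  ℤ.i-j≡0⇒i≡j (coeff p i) (coeff q i) (≡.trans (≡.sym (coeff-- p q i)) (IsZeroP⇒coeff≡0 z i))

≋⇒≈P : ∀ {p q} → p ≋ q → p ≈P q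
≋⇒≈P {p} {q} (coeffwise e) = coeff≡0⇒IsZeroP (p -P q) λ i →
  ≡.trans (coeff-- p q i) (ℤ.i≡j⇒i-j≡0 (e i))

≋-refl : ∀ {p} → p ≋ p
≋-refl = coeffwise λ i → ≡.refl

≋-sym : ∀ {p q} → p ≋ q → q ≋ p
≋-sym (coeffwise e) = coeffwise λ i → ≡.sym (e i)

≋-trans : ∀ {p q r} → p ≋ q → q ≋ r → p ≋ r
≋-trans (coeffwise e) (coeffwise f) = coeffwise λ i → ≡.trans (e i) (f i)

∷-cong : ∀ {a b p q} → a ≡ b → p ≋ q → a ∷ p ≋ b ∷ q
∷-cong e (coeffwise f) = coeffwise λ { zero → e ; (suc i) → f i }

0∷[]≋[] : 0ℤ ∷ [] ≋ []
0∷[]≋[] = coeffwise λ { zero → ≡.refl ; (suc i) → ≡.refl }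

+P-cong : ∀ {p q r s} → p ≋ q → r ≋ s → p +P r ≋ q +P s
+P-cong {p} {q} {r} {s} (coeffwise e) (coeffwise f) = coeffwise λ i →
  ≡.trans (coeff-+ p r i) (≡.trans (≡.cong₂ ℤ._+_ (e i) (f i)) (≡.sym (coeff-+ q s i)))

+P-assoc : ∀ p q r → (p +P q) +P r ≋ p +P (q +P r)
+P-assoc p q r = coeffwise λ i → ≡.trans (coeff-+ (p +P q) r i)
  (≡.trans (≡.cong (ℤ._+ coeff r i) (coeff-+ p q i))
  (≡.trans (ℤ.+-assoc (coeff p i) (coeff q i) (coeff r i))
  (≡.trans (≡.cong (λ x → coeff p i ℤ.+ x) (≡.sym (coeff-+ q r i))) (≡.sym (coeff-+ p (q +P r) i)))))

+P-comm : ∀ p q → p +P q ≋ q +P p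
+P-comm p q = coeffwise λ i → ≡.trans (coeff-+ p q i)
  (≡.trans (ℤ.+-comm (coeff p i) (coeff q i)) (≡.sym (coeff-+ q p i)))

+P-identityʳ : ∀ p → p +P [] ≋ p
+P-identityʳ p = +P-comm p []

+P-inverseˡ : ∀ p → negP p +P p ≋ []
+P-inverseˡ p = coeffwise λ i → ≡.trans (coeff-+ (negP p) p i)
  (≡.trans (≡.cong (ℤ._+ coeff p i) (coeff-neg p i)) (ℤ.+-inverseˡ (coeff p i)))

negP-cong : ∀ {p q} → p ≋ q → negP p ≋ negP q
negP-cong {p} {q} (coeffwise e) = coeffwise λ i →
  ≡.trans (coeff-neg p i) (≡.trans (≡.cong ℤ.-_ (e i)) (≡.sym (coeff-neg q i)))

polyGroup : AbelianGroup 0ℓ 0ℓ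
polyGroup = record
  { Carrier = Poly ; _≈_ = _≋_ ; _∙_ = _+P_ ; ε = [] ; _⁻¹ = negP
  ; isAbelianGroup = record
    { isGroup = record
      { isMonoid = record
        { isSemigroup = record
          { isMagma = record
            { isEquivalence = record { refl = ≋-refl ; sym = ≋-sym ; trans = ≋-trans }
            ; ∙-cong = +P-cong
            }
          ; assoc = +P-assoc
          }
        ; identity = (λ p → ≋-refl) , +P-identityʳ
        }
      ; inverse = +P-inverseˡ , (λ p → ≋-trans (+P-comm p (negP p)) (+P-inverseˡ p))
      ; ⁻¹-cong = negP-cong
      }
    ; comm = +P-comm
    }
  }

private
  module G = AbelianGroup polyGroup
  open import Algebra.Properties.CommutativeSemigroup G.commutativeSemigroup
    using (x∙yz≈y∙xz; interchange)
  module ≋-Reasoning = Relation.Binary.Reasoning.Setoid G.setoid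

scale-cong : ∀ a {p q} → p ≋ q → scale a p ≋ scale a q
scale-cong a {p} {q} (coeffwise e) = coeffwise λ i →
  ≡.trans (coeff-scale a p i) (≡.trans (≡.cong (a ℤ.*_) (e i)) (≡.sym (coeff-scale a q i)))

scale-+ : ∀ a p q → scale a (p +P q) ≋ scale a p +P scale a q
scale-+ a p q = coeffwise λ i → ≡.trans (coeff-scale a (p +P q) i)
  (≡.trans (≡.cong (a ℤ.*_) (coeff-+ p q i))
  (≡.trans (ℤ.*-distribˡ-+ a (coeff p i) (coeff q i))
  (≡.trans (≡.sym (≡.cong₂ ℤ._+_ (coeff-scale a p i) (coeff-scale a q i))) (≡.sym (coeff-+ (scale a p) (scale a q) i)))))

+-scale : ∀ a b p → scale (a ℤ.+ b) p ≋ scale a p +P scale b p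
+-scale a b p = coeffwise λ i → ≡.trans (coeff-scale (a ℤ.+ b) p i)
  (≡.trans (ℤ.*-distribʳ-+ (coeff p i) a b)
  (≡.trans (≡.sym (≡.cong₂ ℤ._+_ (coeff-scale a p i) (coeff-scale b p i))) (≡.sym (coeff-+ (scale a p) (scale b p) i))))

scale-scale : ∀ a b p → scale (a ℤ.* b) p ≋ scale a (scale b p)
scale-scale a b p = coeffwise λ i → ≡.trans (coeff-scale (a ℤ.* b) p i)
  (≡.trans (ℤ.*-assoc a b (coeff p i))
  (≡.trans (≡.cong (a ℤ.*_) (≡.sym (coeff-scale b p i))) (≡.sym (coeff-scale a (scale b p) i))))

scale-1 : ∀ p → scale 1ℤ p ≋ p
scale-1 p = coeffwise λ i → ≡.trans (coeff-scale 1ℤ p i) (ℤ.*-identityˡ _)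

scale-0 : ∀ p → scale 0ℤ p ≋ []
scale-0 p = coeffwise λ i → ≡.trans (coeff-scale 0ℤ p i) (ℤ.*-zeroˡ (coeff p i))

*P-zeroʳ : ∀ p → p *P [] ≋ []
*P-zeroʳ []      = ≋-refl
*P-zeroʳ (a ∷ p) = ≋-trans (∷-cong ≡.refl (*P-zeroʳ p)) 0∷[]≋[]

*P-congˡ : ∀ p {q r} → q ≋ r → p *P q ≋ p *P r
*P-congˡ []      e = ≋-refl
*P-congˡ (a ∷ p) e = +P-cong (scale-cong a e) (∷-cong ≡.refl (*P-congˡ p e))

-- `_*P_` recurses on its left factor; this is the mirrored recursion, from which commutativity
-- follows.
*P-∷ : ∀ p b q → p *P (b ∷ q) ≋ scale b p +P (0ℤ ∷ p *P q)
*P-∷ []      b q = ≋-sym 0∷[]≋[]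
*P-∷ (a ∷ p) b q = ∷-cong (≡.cong (ℤ._+ 0ℤ) (ℤ.*-comm a b)) (begin
  scale a q +P p *P (b ∷ q)                    ≈⟨ +P-cong (≋-refl {scale a q}) (*P-∷ p b q) ⟩
  scale a q +P (scale b p +P (0ℤ ∷ p *P q))    ≈⟨ x∙yz≈y∙xz (scale a q) (scale b p) (0ℤ ∷ p *P q) ⟩
  scale b p +P (scale a q +P (0ℤ ∷ p *P q))    ∎)
  where open ≋-Reasoning

*P-comm : ∀ p q → p *P q ≋ q *P p
*P-comm []      q = ≋-sym (*P-zeroʳ q)
*P-comm (a ∷ p) q = ≋-trans (+P-cong (≋-refl {scale a q}) (∷-cong ≡.refl (*P-comm p q))) (≋-sym (*P-∷ q a p))

*P-cong : ∀ {p q r s} → p ≋ q → r ≋ s → p *P r ≋ q *P s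
*P-cong {p} {q} {r} {s} e f = ≋-trans (*P-congˡ p f)
  (≋-trans (*P-comm p s) (≋-trans (*P-congˡ s e) (*P-comm s q)))

*P-distribʳ : ∀ r p q → (p +P q) *P r ≋ p *P r +P q *P r
*P-distribʳ r []      q       = ≋-refl
*P-distribʳ r (a ∷ p) []      = ≋-sym (+P-identityʳ ((a ∷ p) *P r))
*P-distribʳ r (a ∷ p) (b ∷ q) = begin
  scale (a ℤ.+ b) r +P (0ℤ ∷ (p +P q) *P r)
    ≈⟨ +P-cong (+-scale a b r) (∷-cong ≡.refl (*P-distribʳ r p q)) ⟩
  (scale a r +P scale b r) +P ((0ℤ ∷ p *P r) +P (0ℤ ∷ q *P r))
    ≈⟨ interchange (scale a r) (scale b r) (0ℤ ∷ p *P r) (0ℤ ∷ q *P r) ⟩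
  (a ∷ p) *P r +P (b ∷ q) *P r ∎
  where open ≋-Reasoning

*P-distribˡ : ∀ r p q → r *P (p +P q) ≋ r *P p +P r *P q
*P-distribˡ r p q = ≋-trans (*P-comm r (p +P q))
  (≋-trans (*P-distribʳ r p q) (+P-cong (*P-comm p r) (*P-comm q r)))

0∷-*P : ∀ p q → (0ℤ ∷ p) *P q ≋ 0ℤ ∷ p *P q
0∷-*P p q = +P-cong (scale-0 q) ≋-refl

scale-*P : ∀ a p q → scale a p *P q ≋ scale a (p *P q)
scale-*P a []      q = ≋-refl
scale-*P a (b ∷ p) q = begin
  scale (a ℤ.* b) q +P (0ℤ ∷ scale a p *P q)
    ≈⟨ +P-cong (scale-scale a b q) (∷-cong (≡.sym (ℤ.*-zeroʳ a)) (scale-*P a p q)) ⟩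
  scale a (scale b q) +P scale a (0ℤ ∷ p *P q)
    ≈⟨ ≋-sym (scale-+ a (scale b q) (0ℤ ∷ p *P q)) ⟩
  scale a ((b ∷ p) *P q) ∎
  where open ≋-Reasoning

*P-assoc : ∀ p q r → (p *P q) *P r ≋ p *P (q *P r)
*P-assoc []      q r = ≋-refl
*P-assoc (a ∷ p) q r = begin
  (scale a q +P (0ℤ ∷ p *P q)) *P r
    ≈⟨ *P-distribʳ r (scale a q) (0ℤ ∷ p *P q) ⟩
  scale a q *P r +P (0ℤ ∷ p *P q) *P r
    ≈⟨ +P-cong (scale-*P a q r) (≋-trans (0∷-*P (p *P q) r) (∷-cong ≡.refl (*P-assoc p q r))) ⟩
  (a ∷ p) *P (q *P r) ∎
  where open ≋-Reasoning

constant-*P : ∀ a p → (a ∷ []) *P p ≋ scale a p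
constant-*P a p = ≋-trans (+P-cong (≋-refl {scale a p}) 0∷[]≋[]) (+P-identityʳ (scale a p))

*P-identityˡ : ∀ p → oneP *P p ≋ p
*P-identityˡ p = ≋-trans (constant-*P 1ℤ p) (scale-1 p)

abstract
  poly-isCommutativeRing : IsCommutativeRing _≋_ _+P_ _*P_ negP zeroP oneP
  poly-isCommutativeRing = record
    { isRing = record
      { +-isAbelianGroup = G.isAbelianGroup
      ; *-cong = *P-cong
      ; *-assoc = *P-assoc
      ; *-identity = *P-identityˡ , (λ p → ≋-trans (*P-comm p oneP) (*P-identityˡ p))
      ; distrib = *P-distribˡ , *P-distribʳ
      }
    ; *-comm = *P-comm
    }

polyRing : CommutativeRing 0ℓ 0ℓ
polyRing = record
  { Carrier = Poly ; _≈_ = _≋_ ; _+_ = _+P_ ; _*_ = _*P_ ; -_ = negP ; 0# = zeroP ; 1# = oneP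
  ; isCommutativeRing = poly-isCommutativeRing
  }

constantAlgebra : ℤ-Algebra polyRing
constantAlgebra = record
  { ⟦_⟧    = λ a → a ∷ []
  ; +-homo = λ a b → ≋-refl
  ; *-homo = λ a b → ≋-sym (constant-*P a (b ∷ []))
  ; -‿homo = λ a → ≋-refl
  ; 0-homo = 0∷[]≋[]
  ; 1-homo = ≋-refl
  }

-- Division by monic polynomials

open Algebraic polyRing constantAlgebra

X : Poly
X = 0ℤ ∷ oneP

0∷≋X* : ∀ p → 0ℤ ∷ p ≋ X * p
0∷≋X* p = sym (trans (0∷-*P oneP p) (∷-cong ≡.refl (*P-identityˡ p)))

∷≋ : ∀ a p → a ∷ p ≋ ⟦ a ⟧ + X * p
∷≋ a p = trans (∷-cong (≡.sym (ℤ.+-identityʳ a)) refl) (+-congˡ {x = ⟦ a ⟧} (0∷≋X* p))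

qpow≋X^ : ∀ n → qpow n ≋ X ^ n
qpow≋X^ zero    = refl
qpow≋X^ (suc n) = trans (0∷≋X* (qpow n)) (*-congˡ {x = X} (qpow≋X^ n))

++-snoc : ∀ p x → p ++ x ∷ [] ≋ p + ⟦ x ⟧ * X ^ length p
++-snoc []      x = sym (*-identityʳ ⟦ x ⟧)
++-snoc (a ∷ p) x = begin
  a ∷ (p ++ x ∷ [])                                    ≈⟨ ∷≋ a _ ⟩
  ⟦ a ⟧ + X * (p ++ x ∷ [])                            ≈⟨ +-congˡ {x = ⟦ a ⟧} (*-congˡ {x = X} (++-snoc p x)) ⟩
  ⟦ a ⟧ + X * (p + ⟦ x ⟧ * X ^ length p)               ≈⟨ regroup ⟦ a ⟧ X p ⟦ x ⟧ (X ^ length p) ⟩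
  ⟦ a ⟧ + X * p + ⟦ x ⟧ * X ^ length (a ∷ p)           ≈⟨ +-congʳ (sym (∷≋ a p)) ⟩
  (a ∷ p) + ⟦ x ⟧ * X ^ length (a ∷ p)                 ∎
  where
  regroup : ∀ a X p x y → a + X * (p + x * y) ≈ a + X * p + x * (X * y)
  regroup = solve 5 (λ a X p x y → a :+ X :* (p :+ x :* y) := a :+ X :* p :+ x :* (X :* y)) refl

reverse-∷ : ∀ x l → reverse (x ∷ l) ≋ reverse l + ⟦ x ⟧ * X ^ length l
reverse-∷ x l = trans (reflexive (List.unfold-reverse x l)) (trans (++-snoc (reverse l) x)
  (reflexive (≡.cong (λ k → reverse l + ⟦ x ⟧ * X ^ k) (List.length-reverse l))))

-- Exposes the leading 1 in the order in which the division algorithm reads coefficients.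
Monic : Poly → Set
Monic p = ∃[ l ] p ≋ reverse (1ℤ ∷ l)

Monic-resp : ∀ {p q} → p ≋ q → Monic p → Monic q
Monic-resp e (l , f) = l , trans (sym e) f

-- Products of coefficient lists written highest degree first, the right factor without its leading 1.

infixl 6 _+H_
_+H_ : List ℤ → List ℤ → List ℤ
[]      +H v       = v
(x ∷ u) +H []      = x ∷ u
(x ∷ u) +H (y ∷ v) = (x ℤ.+ y) ∷ (u +H v)

infixl 7 _*H1∷_
_*H1∷_ : List ℤ → List ℤ → List ℤ
[]      *H1∷ ds = replicate (length ds) 0ℤ
(x ∷ c) *H1∷ ds = x ∷ (scale x ds +H c *H1∷ ds)

length-+H : ∀ k u v → length v ≡ k ℕ.+ length u → length (u +H v) ≡ length v
length-+H k []      v       e = ≡.refl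
length-+H k (x ∷ u) []      e with k
length-+H k (x ∷ u) []      () | zero
length-+H k (x ∷ u) []      () | suc _
length-+H k (x ∷ u) (y ∷ v) e = ≡.cong suc
  (length-+H k u v (ℕ.suc-injective (≡.trans e (ℕ.+-suc k (length u)))))

length-*H : ∀ c ds → length (c *H1∷ ds) ≡ length c ℕ.+ length ds
length-+H-*H : ∀ x c ds → length (scale x ds +H c *H1∷ ds) ≡ length c ℕ.+ length ds

length-*H []      ds = List.length-replicate (length ds)
length-*H (x ∷ c) ds = ≡.cong suc (length-+H-*H x c ds)

length-scale : ∀ x c ds → length (c *H1∷ ds) ≡ length c ℕ.+ length (scale x ds)
length-scale x c ds = ≡.trans (length-*H c ds) (≡.cong (length c ℕ.+_) (≡.sym (List.length-map (x ℤ.*_) ds)))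

length-+H-*H x c ds = ≡.trans (length-+H (length c) (scale x ds) (c *H1∷ ds) (length-scale x c ds)) (length-*H c ds)

-- The lists are aligned at their top degree, so the shorter one is shifted up by the difference `k`
-- of the lengths.
reverse-+H : ∀ k u v → length v ≡ k ℕ.+ length u → reverse (u +H v) ≋ reverse v + X ^ k * reverse u
reverse-+H k []      v e = sym (trans (+-congˡ {x = reverse v} (zeroʳ (X ^ k))) (+-identityʳ (reverse v)))
reverse-+H k (x ∷ u) [] e with k
reverse-+H k (x ∷ u) []      () | zero
reverse-+H k (x ∷ u) []      () | suc _
reverse-+H k (x ∷ u) (y ∷ v) e = begin
  reverse ((x ℤ.+ y) ∷ (u +H v))
    ≈⟨ reverse-∷ (x ℤ.+ y) (u +H v) ⟩
  reverse (u +H v) + ⟦ x ℤ.+ y ⟧ * X ^ length (u +H v)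
    ≈⟨ +-cong (reverse-+H k u v e′) (*-cong {⟦ x ℤ.+ y ⟧} (+-homo x y) (reflexive (≡.cong (X ^_) (length-+H k u v e′)))) ⟩
  reverse v + X ^ k * reverse u + (⟦ x ⟧ + ⟦ y ⟧) * X ^ length v
    ≈⟨ solve 6 (λ v k u x y z → v :+ k :* u :+ (x :+ y) :* z := v :+ y :* z :+ (k :* u :+ x :* z)) refl
         (reverse v) (X ^ k) (reverse u) ⟦ x ⟧ ⟦ y ⟧ (X ^ length v) ⟩
  reverse v + ⟦ y ⟧ * X ^ length v + (X ^ k * reverse u + ⟦ x ⟧ * X ^ length v)
    ≈⟨ +-cong (sym (reverse-∷ y v)) (+-congˡ {x = X ^ k * reverse u} (*-congˡ {x = ⟦ x ⟧}
         (trans (reflexive (≡.cong (X ^_) e′)) (^-homo-* X k (length u))))) ⟩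
  reverse (y ∷ v) + (X ^ k * reverse u + ⟦ x ⟧ * (X ^ k * X ^ length u))
    ≈⟨ +-congˡ {x = reverse (y ∷ v)} (solve 4 (λ k u x z → k :* u :+ x :* (k :* z) := k :* (u :+ x :* z)) refl
         (X ^ k) (reverse u) ⟦ x ⟧ (X ^ length u)) ⟩
  reverse (y ∷ v) + X ^ k * (reverse u + ⟦ x ⟧ * X ^ length u)
    ≈⟨ +-congˡ {x = reverse (y ∷ v)} (*-congˡ {x = X ^ k} (sym (reverse-∷ x u))) ⟩
  reverse (y ∷ v) + X ^ k * reverse (x ∷ u) ∎
  where
  e′ : length v ≡ k ℕ.+ length u
  e′ = ℕ.suc-injective (≡.trans e (ℕ.+-suc k (length u)))

replicate-0 : ∀ n → replicate n 0ℤ ≋ zeroP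
replicate-0 zero    = refl
replicate-0 (suc n) = trans (∷-cong ≡.refl (replicate-0 n)) 0∷[]≋[]

reverse-scale : ∀ x l → reverse (scale x l) ≋ ⟦ x ⟧ * reverse l
reverse-scale x l = trans (reflexive (≡.sym (List.reverse-map (x ℤ.*_) l))) (sym (constant-*P x (reverse l)))

reverse-replicate : ∀ n → reverse (replicate n 0ℤ) ≋ zeroP
reverse-replicate zero    = refl
reverse-replicate (suc n) = trans (reverse-∷ 0ℤ (replicate n 0ℤ))
  (trans (+-cong (reverse-replicate n) (trans (*-congʳ {x = X ^ length (replicate n 0ℤ)} 0∷[]≋[]) (zeroˡ (X ^ length (replicate n 0ℤ))))) refl)

reverse-*H : ∀ c ds → reverse (c *H1∷ ds) ≋ reverse c * reverse (1ℤ ∷ ds)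
reverse-*H []      ds = reverse-replicate (length ds)
reverse-*H (x ∷ c) ds = begin
  reverse (x ∷ (scale x ds +H c *H1∷ ds))
    ≈⟨ reverse-∷ x (scale x ds +H c *H1∷ ds) ⟩
  reverse (scale x ds +H c *H1∷ ds) + ⟦ x ⟧ * X ^ length (scale x ds +H c *H1∷ ds)
    ≈⟨ +-cong (reverse-+H (length c) (scale x ds) (c *H1∷ ds) (length-scale x c ds))
         (*-congˡ {x = ⟦ x ⟧} (trans (reflexive (≡.cong (X ^_) (length-+H-*H x c ds))) (^-homo-* X (length c) (length ds)))) ⟩
  reverse (c *H1∷ ds) + C * reverse (scale x ds) + ⟦ x ⟧ * (C * D)
    ≈⟨ +-congʳ {x = ⟦ x ⟧ * (C * D)} (+-cong (reverse-*H c ds) (*-congˡ {x = C} (reverse-scale x ds))) ⟩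
  reverse c * reverse (1ℤ ∷ ds) + C * (⟦ x ⟧ * reverse ds) + ⟦ x ⟧ * (C * D)
    ≈⟨ solve 5 (λ a C x ds D → a :+ C :* (x :* ds) :+ x :* (C :* D) := a :+ x :* C :* (ds :+ :1 :* D)) refl
         (reverse c * reverse (1ℤ ∷ ds)) C ⟦ x ⟧ (reverse ds) D ⟩
  reverse c * reverse (1ℤ ∷ ds) + ⟦ x ⟧ * C * (reverse ds + oneP * D)
    ≈⟨ +-congˡ {x = reverse c * reverse (1ℤ ∷ ds)} (*-congˡ {x = ⟦ x ⟧ * C} (sym (reverse-∷ 1ℤ ds))) ⟩
  reverse c * reverse (1ℤ ∷ ds) + ⟦ x ⟧ * C * reverse (1ℤ ∷ ds)
    ≈⟨ sym (distribʳ (reverse (1ℤ ∷ ds)) (reverse c) (⟦ x ⟧ * C)) ⟩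
  (reverse c + ⟦ x ⟧ * C) * reverse (1ℤ ∷ ds)
    ≈⟨ *-congʳ {x = reverse (1ℤ ∷ ds)} (sym (reverse-∷ x c)) ⟩
  reverse (x ∷ c) * reverse (1ℤ ∷ ds) ∎
  where
  C = X ^ length c
  D = X ^ length ds

Monic-1 : Monic oneP
Monic-1 = [] , refl

Monic-* : ∀ {p q} → Monic p → Monic q → Monic (p * q)
Monic-* {p} {q} (k , e) (l , f) = scale 1ℤ l +H k *H1∷ l , trans (*-cong e f) (sym (reverse-*H (1ℤ ∷ k) l))

-- A normal form: equal polynomials have equal stripped reversals, so the division, which works on
-- lists, can be analysed on a convenient representative.
strip : List ℤ → List ℤ
strip []               = []
strip (+0       ∷ u) = strip u
strip (+[1+ n ] ∷ u) = +[1+ n ] ∷ u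
strip (-[1+ n ] ∷ u) = -[1+ n ] ∷ u

private
  glue : List ℤ → List ℤ → List ℤ
  glue []      v = strip v
  glue (x ∷ u) v = x ∷ u ++ v

  strip-++ : ∀ u v → strip (u ++ v) ≡ glue (strip u) v
  strip-++ []               v = ≡.refl
  strip-++ (+0       ∷ u) v = strip-++ u v
  strip-++ (+[1+ n ] ∷ u) v = ≡.refl
  strip-++ (-[1+ n ] ∷ u) v = ≡.refl

  strip-reverse-∷ : ∀ a p → strip (reverse (a ∷ p)) ≡ glue (strip (reverse p)) (a ∷ [])
  strip-reverse-∷ a p = ≡.trans (≡.cong strip (List.unfold-reverse a p)) (strip-++ (reverse p) (a ∷ []))

∷-injectiveʳ : ∀ {a b p q} → a ∷ p ≋ b ∷ q → p ≋ q
∷-injectiveʳ (coeffwise e) = coeffwise λ i → e (suc i)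

strip-reverse-0 : ∀ {p} → p ≋ [] → strip (reverse p) ≡ []
strip-reverse-0 {[]}    e             = ≡.refl
strip-reverse-0 {a ∷ p} (coeffwise e) = ≡.trans (strip-reverse-∷ a p)
  (≡.cong₂ (λ u x → glue u (x ∷ [])) (strip-reverse-0 {p} (coeffwise λ i → e (suc i))) (e 0))

strip-reverse-cong : ∀ {p q} → p ≋ q → strip (reverse p) ≡ strip (reverse q)
strip-reverse-cong {[]}    {q}     e = ≡.sym (strip-reverse-0 (sym e))
strip-reverse-cong {a ∷ p} {[]}    e = strip-reverse-0 e
strip-reverse-cong {a ∷ p} {b ∷ q} e = ≡.trans (strip-reverse-∷ a p) (≡.trans
  (≡.cong₂ (λ u x → glue u (x ∷ [])) (strip-reverse-cong (∷-injectiveʳ e)) (_≋_.at e 0))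
  (≡.sym (strip-reverse-∷ b q)))

reverse-strip : ∀ u → reverse (strip u) ≋ reverse u
reverse-strip []               = refl
reverse-strip (+0       ∷ u) = sym (trans (reverse-∷ +0 u) (trans
  (+-congˡ {x = reverse u} (trans (*-congʳ {x = X ^ length u} 0∷[]≋[]) (zeroˡ (X ^ length u))))
  (trans (+-identityʳ (reverse u)) (sym (reverse-strip u)))))
reverse-strip (+[1+ n ] ∷ u) = refl
reverse-strip (-[1+ n ] ∷ u) = refl

strip-head : ∀ u {x c} w → strip u ≡ x ∷ c → strip (x ∷ w) ≡ x ∷ w
strip-head (+0       ∷ u) w e      = strip-head u w e
strip-head (+[1+ n ] ∷ u) w ≡.refl = ≡.refl
strip-head (-[1+ n ] ∷ u) w ≡.refl = ≡.refl

-- The functions computing divMonic are private to their module; here they are recovered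
-- by unification from what divMonic unfolds to on suitable arguments.
mutual
  divHigh : List ℤ → List ℤ → List ℤ
  divHigh = _

  divMonic≡divHigh : ∀ p d → divMonic p d ≡ divHigh (reverse p) (reverse d)
  divMonic≡divHigh p d with reverse p | reverse d
  ... | u | v = ≡.refl

mutual
  -- The solution is the loop after its first round: `divStep acc l ds a w` puts onto `acc`, in
  -- reverse, the quotient digits obtained with fuel `l` from `a` minus `w`, aligned at the top.
  divStep : List ℤ → ℕ → List ℤ → List ℤ → List ℤ → List ℤ
  divStep = _

  divHigh-step : ∀ a ds → T (length ds ≤ᵇ length a) →
    divHigh (1ℤ ∷ a) (1ℤ ∷ ds) ≡ divStep (1ℤ ∷ []) (length a) ds a (scale 1ℤ ds)
  divHigh-step a ds h with length a
  ... | l with length ds ≤ᵇ l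
  -- Abstracting these two arguments leaves `divStep` applied to distinct variables, so that
  -- unification has a unique solution.
  ...   | true with scale 1ℤ ds | List ℤ ∋ 1ℤ ∷ []
  ...     | w | acc = ≡.refl

mutual
  subHigh : List ℤ → List ℤ → List ℤ
  subHigh = _

  divStep-∷ : ∀ acc l ds x xs y ys →
    divStep acc l ds (x ∷ xs) (y ∷ ys) ≡ divStep acc l ds ((x ℤ.- y) ∷ subHigh xs ys) []
  divStep-∷ acc l ds x xs y ys = ≡.refl

divHigh-strip : ∀ u v → divHigh u v ≡ divHigh (strip u) (strip v)
divHigh-strip u v = ≡.trans (left u v) (right (strip u) v)
  where
  left : ∀ u v → divHigh u v ≡ divHigh (strip u) v
  left []             v = ≡.refl
  left (+0       ∷ u) v = left u v
  left (+[1+ n ] ∷ u) v = ≡.refl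
  left (-[1+ n ] ∷ u) v = ≡.refl
  right : ∀ u v → divHigh u v ≡ divHigh u (strip v)
  right u []             = ≡.refl
  right u (+0       ∷ v) = right u v
  right u (+[1+ n ] ∷ v) = ≡.refl
  right u (-[1+ n ] ∷ v) = ≡.refl

subHigh-+H : ∀ k u v → length v ≡ k ℕ.+ length u → subHigh (u +H v) u ≡ v
subHigh-+H k []      []      e = ≡.refl
subHigh-+H k []      (y ∷ v) e = ≡.refl
subHigh-+H zero    (x ∷ u) []      ()
subHigh-+H (suc k) (x ∷ u) []      ()
subHigh-+H k (x ∷ u) (y ∷ v) e = ≡.cong₂ _∷_ (cancel x y)
  (subHigh-+H k u v (ℕ.suc-injective (≡.trans e (ℕ.+-suc k (length u)))))
  where
  cancel : ∀ x y → (x ℤ.+ y) ℤ.- x ≡ y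
  cancel x y = ≡.trans (≡.cong (ℤ._- x) (ℤ.+-comm x y)) (≡.trans (ℤ.+-assoc y x (ℤ.- x))
    (≡.trans (≡.cong (λ z → y ℤ.+ z) (ℤ.+-inverseʳ x)) (ℤ.+-identityʳ y)))

T-≤ᵇ : ∀ {m n} k → n ≡ k ℕ.+ m → T (m ≤ᵇ n)
T-≤ᵇ {m} {n} k e = ℕ.≤⇒≤ᵇ (≡.subst (m ℕ.≤_) (≡.sym e) (ℕ.m≤n+m m k))

-- Loop invariant: `w` is a subtraction still pending, `acc` holds the digits already found, and
-- what remains is an exact multiple with quotient `c`; each digit of `c` costs one unit of fuel.
divStep-exact : ∀ acc l ds c a w → subHigh a w ≡ c *H1∷ ds → length c ℕ.≤ l →
  divStep acc l ds a w ≡ foldl (flip _∷_) acc c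
divStep-exact acc zero    ds []      a w e c≤l = ≡.refl
divStep-exact acc (suc l) []       []      a w e c≤l rewrite e = ≡.refl
-- The remainder is now a list of zeros one entry shorter than the divisor with its leading 1, so
-- the length test stops the loop.
divStep-exact acc (suc l) (d ∷ ds) []      a w e c≤l rewrite e
  with length (d ∷ ds) ≤ᵇ length (replicate (length ds) 0ℤ)
     | ℕ.≤ᵇ⇒≤ (length (d ∷ ds)) (length (replicate (length ds) 0ℤ))
... | false | _ = ≡.refl
... | true  | h = ⊥-elim (ℕ.<-irrefl ≡.refl (≡.subst (length (d ∷ ds) ℕ.≤_) (List.length-replicate (length ds)) (h tt)))
divStep-exact acc (suc l) ds (x ∷ c) a w e (ℕ.s≤s c≤l) rewrite e
  with length ds ≤ᵇ length (scale x ds +H c *H1∷ ds)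
     | T-≤ᵇ (length c) (length-+H-*H x c ds)
... | true | _ = divStep-exact (x ∷ acc) l ds c (scale x ds +H c *H1∷ ds) (scale x ds)
  (subHigh-+H (length c) (scale x ds) (c *H1∷ ds) (length-scale x c ds)) c≤l

divHigh-exact : ∀ c ds → divHigh ((1ℤ ∷ c) *H1∷ ds) (1ℤ ∷ ds) ≡ reverse (1ℤ ∷ c)
divHigh-exact c ds = ≡.trans (divHigh-step r ds (T-≤ᵇ (length c) |r|))
  (divStep-exact (1ℤ ∷ []) (length r) ds c r (scale 1ℤ ds)
    (subHigh-+H (length c) (scale 1ℤ ds) (c *H1∷ ds) (length-scale 1ℤ c ds))
    (≡.subst (length c ℕ.≤_) (≡.sym |r|) (ℕ.m≤m+n (length c) (length ds))))
  where
  r = scale 1ℤ ds +H c *H1∷ ds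
  |r| = length-+H-*H 1ℤ c ds

-- `C` may carry trailing zeros, so its stripped reversal is examined. It is nonempty because p is
-- not zero, and its head is the leading coefficient of C d = p, hence 1.
divMonic-exact : ∀ {p d C} → Monic p → Monic d → C * d ≋ p → divMonic p d ≋ C × Monic C
divMonic-exact {p} {d} {C} (l , p≋) (ds , d≋) Cd≋p = go (strip (reverse C)) ≡.refl
  where
  strip-reverse : ∀ {p} l → p ≋ reverse (1ℤ ∷ l) → strip (reverse p) ≡ 1ℤ ∷ l
  strip-reverse l e = ≡.trans (strip-reverse-cong e) (≡.cong strip (List.reverse-involutive (1ℤ ∷ l)))

  C≋ : C ≋ reverse (strip (reverse C))
  C≋ = sym (trans (reverse-strip (reverse C)) (reflexive (List.reverse-involutive C)))

  high : ∀ c → C ≋ reverse c → strip (c *H1∷ ds) ≡ 1ℤ ∷ l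
  high c e = ≡.trans (≡.cong strip (≡.sym (List.reverse-involutive (c *H1∷ ds))))
    (strip-reverse l (trans (reverse-*H c ds) (trans (*-cong (sym e) (sym d≋)) (trans Cd≋p p≋))))

  1∷l≢[] : 1ℤ ∷ l ≢ []
  1∷l≢[] ()

  conclude : ∀ c → C ≋ reverse (1ℤ ∷ c) → divMonic p d ≋ C × Monic C
  conclude c e = trans (reflexive (≡.trans (divMonic≡divHigh p d) (≡.trans (divHigh-strip (reverse p) (reverse d))
    (≡.trans (≡.cong₂ divHigh
      (≡.trans (strip-reverse-cong {p} {reverse ((1ℤ ∷ c) *H1∷ ds)} (trans (sym Cd≋p) (trans (*-cong e d≋) (sym (reverse-*H (1ℤ ∷ c) ds)))))
        (≡.cong strip (List.reverse-involutive ((1ℤ ∷ c) *H1∷ ds))))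
      (strip-reverse ds d≋)) (divHigh-exact c ds))))) (sym e) , c , e

  go : ∀ c → strip (reverse C) ≡ c → divMonic p d ≋ C × Monic C
  go []      e = ⊥-elim (1∷l≢[] (≡.trans (≡.sym (strip-reverse {C * d} l (trans Cd≋p p≋)))
    (strip-reverse-0 {C * d} (*-congʳ {x = d} (trans C≋ (reflexive (≡.cong reverse e)))))))
  go (x ∷ c) e = conclude c (trans C≋ (reflexive (≡.cong reverse (≡.trans e (≡.cong (_∷ c) x≡1)))))
    where
    x≡1 : x ≡ 1ℤ
    x≡1 = List.∷-injectiveˡ (≡.trans (≡.sym (strip-head (reverse C) (scale x ds +H c *H1∷ ds) e))
      (high (x ∷ c) (trans C≋ (reflexive (≡.cong reverse e)))))

Monic-X^n-1 : ∀ n → Monic (X ^ suc n - oneP)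
Monic-X^n-1 n = l , sym (trans (reverse-∷ 1ℤ l) (trans (+-cong reverse-l (trans (*-identityˡ (X ^ length l)) (reflexive (≡.cong (X ^_) |l|))))
    (+-comm (- oneP) (X ^ suc n))))
  where
  l = reverse (-1ℤ ∷ replicate n 0ℤ)
  |l| : length l ≡ suc n
  |l| = ≡.trans (List.length-reverse (-1ℤ ∷ replicate n 0ℤ)) (≡.cong suc (List.length-replicate n))
  reverse-l : reverse l ≋ - oneP
  reverse-l = trans (reflexive (List.reverse-involutive (-1ℤ ∷ replicate n 0ℤ))) (∷-cong ≡.refl (replicate-0 n))

-- Reduced forms

coeff-⟦⟧* : ∀ a p i → coeff (⟦ a ⟧ * p) i ≡ a ℤ.* coeff p i
coeff-⟦⟧* a p i = ≡.trans (_≋_.at (constant-*P a p) i) (coeff-scale a p i)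

⟦⟧*-cong : ∀ {a b} p → a ≡ b → ⟦ a ⟧ * p ≋ ⟦ b ⟧ * p
⟦⟧*-cong p ≡.refl = refl

torsionfree : Torsionfree
torsionfree M p q M≢0 (coeffwise e) = coeffwise λ i → ℤ.*-cancelˡ-≡ M (coeff p i) (coeff q i) {{ℤ.≢-nonZero M≢0}}
  (≡.trans (≡.sym (coeff-⟦⟧* M p i)) (≡.trans (e i) (coeff-⟦⟧* M q i)))

infix 4 _∣coeffs_
_∣coeffs_ : ℤ → Poly → Set
M ∣coeffs p = ∀ i → M ℤ∣.∣ coeff p i

∣⇒∣coeffs : ∀ {M p} → ⟦ M ⟧ ∣ p → M ∣coeffs p
∣⇒∣coeffs {M} {p} (c , coeffwise e) i = ℤ∣.divides (coeff c i) (≡.trans (≡.sym (e i))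
  (≡.trans (_≋_.at (*-comm c ⟦ M ⟧) i) (≡.trans (coeff-⟦⟧* M c i) (ℤ.*-comm M (coeff c i)))))

∣coeffs⇒∣ : ∀ {M} p → M ∣coeffs p → ⟦ M ⟧ ∣ p
∣coeffs⇒∣ []      h = [] , refl
∣coeffs⇒∣ {M} (a ∷ p) h with h 0 | ∣coeffs⇒∣ p (λ i → h (suc i))
... | ℤ∣.divides k e | c , f = k ∷ c ,
  trans (*-comm (k ∷ c) ⟦ M ⟧) (trans (constant-*P M (k ∷ c))
    (∷-cong (≡.trans (ℤ.*-comm M k) (≡.sym e)) (trans (sym (constant-*P M c)) (trans (*-comm ⟦ M ⟧ c) f))))

∣coeffs-resp : ∀ {M p q} → p ≋ q → M ∣coeffs p → M ∣coeffs q
∣coeffs-resp (coeffwise e) h i = ≡.subst (_ ℤ∣.∣_) (e i) (h i)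

∣coeffs-∷ : ∀ {M a p} → M ℤ∣.∣ a → M ∣coeffs p → M ∣coeffs a ∷ p
∣coeffs-∷ h k zero    = h
∣coeffs-∷ h k (suc i) = k i

-- The product has the same constant coefficient as z, so `M` divides it; removing its contribution
-- leaves the same situation for the tail of z.
Primitive-1∷ : ∀ r → Primitive (1ℤ ∷ r)
Primitive-1∷ r M z h = ∣coeffs⇒∣ z (go z (∣⇒∣coeffs h))
  where
  go : ∀ z → M ∣coeffs (1ℤ ∷ r) * z → M ∣coeffs z
  go []      h = λ i → ℤ∣.divides 0ℤ ≡.refl
  go (a ∷ z) h = ∣coeffs-∷ M∣a (go z λ i → ℤ∣.∣m+n∣m⇒∣n
      (≡.subst (M ℤ∣.∣_) (coeff-+ (scale a r) ((1ℤ ∷ r) * z) i) (h′ (suc i)))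
      (≡.subst (M ℤ∣.∣_) (≡.sym (coeff-scale a r i)) (ℤ∣.∣m⇒∣m*n (coeff r i) M∣a)))
    where
    h′ : M ∣coeffs scale a (1ℤ ∷ r) + (0ℤ ∷ (1ℤ ∷ r) * z)
    h′ = ∣coeffs-resp (*P-∷ (1ℤ ∷ r) a z) h
    M∣a : M ℤ∣.∣ a
    M∣a = ≡.subst (M ℤ∣.∣_) (≡.trans (ℤ.+-identityʳ (a ℤ.* 1ℤ)) (ℤ.*-identityʳ a)) (h′ 0)

Primitive-X : Primitive X
Primitive-X M z h = ∣coeffs⇒∣ z λ i → ∣coeffs-resp (sym (0∷≋X* z)) (∣⇒∣coeffs h) (suc i)

-- Gauss's lemma, Bézout relations and reduced fractions in ℤ[q]

euclid : ∀ {p a b} → Prime p → ℤ.+ p ℤ∣.∣ a ℤ.* b → (ℤ.+ p ℤ∣.∣ a) ⊎ (ℤ.+ p ℤ∣.∣ b)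
euclid {p} {a} {b} pp h = Sum.map ℤ∣.∣ᵤ⇒∣ ℤ∣.∣ᵤ⇒∣ (euclidsLemma ℤ.∣ a ∣ ℤ.∣ b ∣ pp
  (≡.subst (p ∣ⁿ_) (ℤ.abs-* a b) (ℤ∣.∣⇒∣ᵤ h)))
  where open import Data.Nat.Divisibility renaming (_∣_ to _∣ⁿ_)

gauss-lemma : ∀ {p} → Prime p → ∀ g h → ℤ.+ p ∣coeffs g * h → (ℤ.+ p ∣coeffs g) ⊎ (ℤ.+ p ∣coeffs h)
gauss-lemma pp []      h       d = inj₁ λ i → ℤ∣.divides 0ℤ ≡.refl
gauss-lemma pp (a ∷ g) []      d = inj₂ λ i → ℤ∣.divides 0ℤ ≡.refl
gauss-lemma {p} pp (a ∷ g) (b ∷ h) d = go (gauss-lemma pp g (b ∷ h)) (gauss-lemma pp (a ∷ g) h) (ℤ.+ p ℤ∣.∣? a) (ℤ.+ p ℤ∣.∣? b)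
  where
  shift : ∀ {a r s} → ℤ.+ p ℤ∣.∣ a → (∀ i → ℤ.+ p ℤ∣.∣ coeff (scale a r + s) i) → ℤ.+ p ∣coeffs s
  shift {a} {r} {s} p∣a d i = ℤ∣.∣m+n∣m⇒∣n (≡.subst (ℤ.+ p ℤ∣.∣_) (coeff-+ (scale a r) s i) (d i))
    (≡.subst (ℤ.+ p ℤ∣.∣_) (≡.sym (coeff-scale a r i)) (ℤ∣.∣m⇒∣m*n (coeff r i) p∣a))

  go : (ℤ.+ p ∣coeffs g * (b ∷ h) → (ℤ.+ p ∣coeffs g) ⊎ (ℤ.+ p ∣coeffs b ∷ h)) →
       (ℤ.+ p ∣coeffs (a ∷ g) * h → (ℤ.+ p ∣coeffs a ∷ g) ⊎ (ℤ.+ p ∣coeffs h)) →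
       Dec (ℤ.+ p ℤ∣.∣ a) → Dec (ℤ.+ p ℤ∣.∣ b) → (ℤ.+ p ∣coeffs a ∷ g) ⊎ (ℤ.+ p ∣coeffs b ∷ h)
  go recˡ recʳ (yes p∣a) _         = Sum.map₁ (∣coeffs-∷ p∣a) (recˡ
    (shift {a} {h} p∣a λ i → d (suc i)))
  go recˡ recʳ (no _)    (yes p∣b) = Sum.map₂ (∣coeffs-∷ p∣b) (recʳ
    (shift {b} {g} p∣b λ i → ∣coeffs-resp (*P-∷ (a ∷ g) b h) d (suc i)))
  go recˡ recʳ (no p∤a)  (no p∤b)  = ⊥-elim (Sum.[ p∤a , p∤b ]
    (euclid pp (≡.subst (ℤ.+ p ℤ∣.∣_) (ℤ.+-identityʳ (a ℤ.* b)) (d 0))))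

-- Since m is not a unit, m b = t g does not exhibit g as a divisor of b; only after m is
-- distributed over the two factors does b = t′ g′ hold.
record Split (m : ℤ) (b t g : Poly) : Set where
  constructor split
  field
    η γ   : ℤ
    t′ g′ : Poly
    m≡ηγ  : m ≡ η ℤ.* γ
    t≋    : t ≋ ⟦ η ⟧ * t′
    g≋    : g ≋ ⟦ γ ⟧ * g′
    t′g′≋ : t′ * g′ ≋ b

private
  ⟦*⟧* : ∀ x y p → ⟦ x ℤ.* y ⟧ * p ≋ ⟦ x ⟧ * (⟦ y ⟧ * p)
  ⟦*⟧* x y p = trans (*-congʳ {x = p} (*-homo x y)) (*-assoc ⟦ x ⟧ ⟦ y ⟧ p)

-- If g h = m b, the prime factors of m distribute over g and h.
split-primes : ∀ ε ps {b t g} → ε ℤ.* ε ≡ 1ℤ → All Prime ps →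
  ⟦ ε ℤ.* ℤ.+ ℕ.product ps ⟧ * b ≋ t * g → Split (ε ℤ.* ℤ.+ ℕ.product ps) b t g
-- Only the sign ε is left; `t` absorbs it, as ε² = 1.
split-primes ε [] {b} {t} {g} εε≡1 [] e = split ε 1ℤ (⟦ ε ⟧ * t) g ≡.refl
  (sym (ε² t)) (sym (*-identityˡ g))
  (trans (*-assoc ⟦ ε ⟧ t g) (trans (*-congˡ {x = ⟦ ε ⟧} (trans (sym e) (⟦⟧*-cong b (ℤ.*-identityʳ ε)))) (ε² b)))
  where
  ε² : ∀ p → ⟦ ε ⟧ * (⟦ ε ⟧ * p) ≋ p
  ε² p = trans (sym (⟦*⟧* ε ε p)) (trans (⟦⟧*-cong p εε≡1) (*-identityˡ p))
split-primes ε (p ∷ ps) {b} {t} {g} εε≡1 (pp ∷ pps) e = go (gauss-lemma pp t g (∣⇒∣coeffs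
    (⟦ m′ ⟧ * b , trans (*-comm (⟦ m′ ⟧ * b) ⟦ ℤ.+ p ⟧) e′)))
  where
  m′ = ε ℤ.* ℤ.+ ℕ.product ps
  m≡ : ε ℤ.* ℤ.+ ℕ.product (p ∷ ps) ≡ ℤ.+ p ℤ.* m′
  m≡ = ≡.trans (≡.cong (ε ℤ.*_) (ℤ.pos-* p (ℕ.product ps)))
    (≡.trans (≡.sym (ℤ.*-assoc ε (ℤ.+ p) (ℤ.+ ℕ.product ps)))
    (≡.trans (≡.cong (ℤ._* ℤ.+ ℕ.product ps) (ℤ.*-comm ε (ℤ.+ p))) (ℤ.*-assoc (ℤ.+ p) ε (ℤ.+ ℕ.product ps))))
  e′ : ⟦ ℤ.+ p ⟧ * (⟦ m′ ⟧ * b) ≋ t * g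
  e′ = trans (sym (⟦*⟧* (ℤ.+ p) m′ b)) (trans (⟦⟧*-cong b (≡.sym m≡)) e)
  p≢0 : ℤ.+ p ≢ 0ℤ
  p≢0 e = ℕ.≢-nonZero⁻¹ p {{prime⇒nonZero pp}} (ℤ.+-injective e)
  go : (ℤ.+ p ∣coeffs t) ⊎ (ℤ.+ p ∣coeffs g) → Split (ε ℤ.* ℤ.+ ℕ.product (p ∷ ps)) b t g
  go (inj₁ h) with ∣coeffs⇒∣ t h
  ... | t₁ , t₁p≋t with split-primes ε ps {b} {t₁} {g} εε≡1 pps (torsionfree (ℤ.+ p) _ _ p≢0 (trans e′
        (trans (*-congʳ {x = g} (trans (sym t₁p≋t) (*-comm t₁ ⟦ ℤ.+ p ⟧))) (*-assoc ⟦ ℤ.+ p ⟧ t₁ g))))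
  ... | split η γ t′ g′ m′≡ t₁≋ g≋ t′g′≋ = split (ℤ.+ p ℤ.* η) γ t′ g′
        (≡.trans m≡ (≡.trans (≡.cong (ℤ.+ p ℤ.*_) m′≡) (≡.sym (ℤ.*-assoc (ℤ.+ p) η γ))))
        (trans (sym t₁p≋t) (trans (*-comm t₁ ⟦ ℤ.+ p ⟧) (trans (*-congˡ {x = ⟦ ℤ.+ p ⟧} t₁≋) (sym (⟦*⟧* (ℤ.+ p) η t′)))))
        g≋ t′g′≋
  go (inj₂ h) with ∣coeffs⇒∣ g h
  ... | g₁ , g₁p≋g with split-primes ε ps {b} {t} {g₁} εε≡1 pps (torsionfree (ℤ.+ p) _ _ p≢0 (trans e′
        (trans (*-congˡ {x = t} (trans (sym g₁p≋g) (*-comm g₁ ⟦ ℤ.+ p ⟧)))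
          (solve 3 (λ t p g → t :* (p :* g) := p :* (t :* g)) refl t ⟦ ℤ.+ p ⟧ g₁))))
  ... | split η γ t′ g′ m′≡ t≋ g₁≋ t′g′≋ = split η (ℤ.+ p ℤ.* γ) t′ g′
        (≡.trans m≡ (≡.trans (≡.cong (ℤ.+ p ℤ.*_) m′≡) (swap (ℤ.+ p) η γ))) t≋
        (trans (sym g₁p≋g) (trans (*-comm g₁ ⟦ ℤ.+ p ⟧) (trans (*-congˡ {x = ⟦ ℤ.+ p ⟧} g₁≋) (sym (⟦*⟧* (ℤ.+ p) γ g′)))))
        t′g′≋
    where
    swap : ∀ p η γ → p ℤ.* (η ℤ.* γ) ≡ η ℤ.* (p ℤ.* γ)
    swap p η γ = ≡.trans (≡.sym (ℤ.*-assoc p η γ)) (≡.trans (≡.cong (ℤ._* γ) (ℤ.*-comm p η)) (ℤ.*-assoc η p γ))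

split-scalar : ∀ m {b t g} → m ≢ 0ℤ → ⟦ m ⟧ * b ≋ t * g → Split m b t g
split-scalar +0       m≢0 e = ⊥-elim (m≢0 ≡.refl)
split-scalar m@(+[1+ n ]) {b} {t} {g} m≢0 e = ≡.subst (λ m → Split m b t g) m≡
    (split-primes 1ℤ (factors f) ≡.refl (factorsPrime f) (trans (⟦⟧*-cong b m≡) e))
  where
  open PrimeFactorisation
  f = factorise (suc n)
  m≡ : 1ℤ ℤ.* ℤ.+ ℕ.product (factors f) ≡ m
  m≡ = ≡.trans (ℤ.*-identityˡ _) (≡.cong ℤ.+_ (≡.sym (isFactorisation f)))
split-scalar m@(-[1+ n ]) {b} {t} {g} m≢0 e = ≡.subst (λ m → Split m b t g) m≡
    (split-primes -1ℤ (factors f) ≡.refl (factorsPrime f) (trans (⟦⟧*-cong b m≡) e))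
  where
  open PrimeFactorisation
  f = factorise (suc n)
  m≡ : -1ℤ ℤ.* ℤ.+ ℕ.product (factors f) ≡ m
  m≡ = ≡.trans (≡.cong (λ k → -1ℤ ℤ.* ℤ.+ k) (≡.sym (isFactorisation f))) (ℤ.-1*i≡-i (+[1+ n ]))

-- A common divisor of a and b, up to integer factors, with cofactors generating a nonzero integer.
record Bezout (a b : Poly) : Set where
  constructor bezout
  field
    m M       : ℤ
    g s t u v : Poly
    m≢0       : m ≢ 0ℤ
    M≢0       : M ≢ 0ℤ
    ma≋sg     : ⟦ m ⟧ * a ≋ s * g
    mb≋tg     : ⟦ m ⟧ * b ≋ t * g
    us+vt≋M   : u * s + v * t ≋ ⟦ M ⟧

private
  1≢0 : 1ℤ ≢ 0ℤ
  1≢0 ()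

  *≢0 : ∀ {i j} → i ≢ 0ℤ → j ≢ 0ℤ → i ℤ.* j ≢ 0ℤ
  *≢0 {i} i≢0 j≢0 e = Sum.[ i≢0 , j≢0 ] (ℤ.i*j≡0⇒i≡0∨j≡0 i e)

coeff-0-* : ∀ p q → coeff (p * q) 0 ≡ coeff p 0 ℤ.* coeff q 0
coeff-0-* []      q       = ≡.sym (ℤ.*-zeroˡ (coeff q 0))
coeff-0-* (a ∷ p) []      = ≡.sym (ℤ.*-zeroʳ a)
coeff-0-* (a ∷ p) (b ∷ q) = ℤ.+-identityʳ (a ℤ.* b)

tail : Poly → Poly
tail []      = []
tail (a ∷ p) = p

head+X*tail : ∀ p → p ≋ ⟦ coeff p 0 ⟧ + X * tail p
head+X*tail []      = sym (trans (+-cong 0∷[]≋[] (zeroʳ X)) refl)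
head+X*tail (a ∷ p) = ∷≋ a p

Bezout-0 : ∀ a → Bezout a []
Bezout-0 a = bezout 1ℤ 1ℤ a oneP [] oneP [] 1≢0 1≢0 refl (zeroʳ ⟦ 1ℤ ⟧) refl

Bezout-sym : ∀ {a b} → Bezout a b → Bezout b a
Bezout-sym (bezout m M g s t u v m≢0 M≢0 ea eb e) = bezout m M g t s v u m≢0 M≢0 eb ea (trans (+-comm (v * t) (u * s)) e)

Bezout-X : ∀ {a b} → Bezout a b → Bezout (X * a) (X * b)
Bezout-X {a} {b} (bezout m M g s t u v m≢0 M≢0 ea eb e) =
  bezout m M (X * g) s t u v m≢0 M≢0 (shift a s ea) (shift b t eb) e
  where
  shift : ∀ a s → ⟦ m ⟧ * a ≋ s * g → ⟦ m ⟧ * (X * a) ≋ s * (X * g)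
  shift a s ea = begin
    ⟦ m ⟧ * (X * a)  ≈⟨ solve 3 (λ m x a → m :* (x :* a) := x :* (m :* a)) refl ⟦ m ⟧ X a ⟩
    X * (⟦ m ⟧ * a)  ≈⟨ *-congˡ {x = X} ea ⟩
    X * (s * g)      ≈⟨ solve 3 (λ s x a → x :* (s :* a) := s :* (x :* a)) refl s X g ⟩
    s * (X * g)      ∎

-- X is coprime to b as soon as b has a nonzero constant coefficient.
Bezout-Xˡ : ∀ {a b} → coeff b 0 ≢ 0ℤ → Bezout a b → Bezout (X * a) b
Bezout-Xˡ {a} {b} b₀≢0 (bezout m M g s t u v m≢0 M≢0 ea eb e) =
  -- The cofactors arise from u s + v t = M on multiplying by t₀ and writing t₀ = t - X t′ in the
  -- first summand. That t₀ is nonzero follows from m b₀ = t₀ g₀.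
  bezout m (t₀ ℤ.* M) g (X * s) t (- (u * tail t)) (u * s + v * ⟦ t₀ ⟧) m≢0 (*≢0 t₀≢0 M≢0)
    (trans (solve 3 (λ m x a → m :* (x :* a) := x :* (m :* a)) refl ⟦ m ⟧ X a)
      (trans (*-congˡ {x = X} ea) (sym (*-assoc X s g))))
    eb
    (begin
      - (u * t′) * (X * s) + (u * s + v * ⟦ t₀ ⟧) * t
        ≈⟨ +-congˡ {x = - (u * t′) * (X * s)} (trans (distribʳ t (u * s) (v * ⟦ t₀ ⟧)) (+-congʳ {x = v * ⟦ t₀ ⟧ * t} (*-congˡ {x = u * s} (head+X*tail t)))) ⟩
      - (u * t′) * (X * s) + (u * s * (⟦ t₀ ⟧ + X * t′) + v * ⟦ t₀ ⟧ * t)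
        ≈⟨ solve 7 (λ u t′ x s c v t → :- (u :* t′) :* (x :* s) :+ (u :* s :* (c :+ x :* t′) :+ v :* c :* t) := c :* (u :* s :+ v :* t)) refl
             u t′ X s ⟦ t₀ ⟧ v t ⟩
      ⟦ t₀ ⟧ * (u * s + v * t)
        ≈⟨ *-congˡ {x = ⟦ t₀ ⟧} e ⟩
      ⟦ t₀ ⟧ * ⟦ M ⟧
        ≈⟨ sym (*-homo t₀ M) ⟩
      ⟦ t₀ ℤ.* M ⟧ ∎)
  where
  t₀ = coeff t 0
  t′ = tail t
  t₀≢0 : t₀ ≢ 0ℤ
  t₀≢0 t₀≡0 = *≢0 m≢0 b₀≢0 (≡.trans (≡.sym (coeff-⟦⟧* m b 0)) (≡.trans (_≋_.at eb 0)
    (≡.trans (coeff-0-* t g) (≡.trans (≡.cong (ℤ._* coeff g 0) t₀≡0) (ℤ.*-zeroˡ (coeff g 0))))))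

-- One step of pseudo-division undone: the cofactors for (c, b) serve (a, b) after both integers are
-- multiplied by β.
Bezout-combine : ∀ {a b c} α β → β ≢ 0ℤ → ⟦ β ⟧ * a ≋ c + ⟦ α ⟧ * b → Bezout c b → Bezout a b
Bezout-combine {a} {b} {c} α β β≢0 h (bezout m M g s t u v m≢0 M≢0 ec eb e) =
  bezout (m ℤ.* β) (β ℤ.* M) g (s + ⟦ α ⟧ * t) (⟦ β ⟧ * t) (⟦ β ⟧ * u) (v + - (u * ⟦ α ⟧))
    (*≢0 m≢0 β≢0) (*≢0 β≢0 M≢0)
    (begin
      ⟦ m ℤ.* β ⟧ * a                         ≈⟨ ⟦*⟧* m β a ⟩
      ⟦ m ⟧ * (⟦ β ⟧ * a)                     ≈⟨ *-congˡ {x = ⟦ m ⟧} h ⟩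
      ⟦ m ⟧ * (c + ⟦ α ⟧ * b)                 ≈⟨ solve 4 (λ m c α b → m :* (c :+ α :* b) := m :* c :+ α :* (m :* b)) refl ⟦ m ⟧ c ⟦ α ⟧ b ⟩
      ⟦ m ⟧ * c + ⟦ α ⟧ * (⟦ m ⟧ * b)         ≈⟨ +-cong ec (*-congˡ {x = ⟦ α ⟧} eb) ⟩
      s * g + ⟦ α ⟧ * (t * g)                 ≈⟨ solve 4 (λ s g α t → s :* g :+ α :* (t :* g) := (s :+ α :* t) :* g) refl s g ⟦ α ⟧ t ⟩
      (s + ⟦ α ⟧ * t) * g                     ∎)
    (begin
      ⟦ m ℤ.* β ⟧ * b                         ≈⟨ ⟦⟧*-cong b (ℤ.*-comm m β) ⟩
      ⟦ β ℤ.* m ⟧ * b                         ≈⟨ ⟦*⟧* β m b ⟩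
      ⟦ β ⟧ * (⟦ m ⟧ * b)                     ≈⟨ *-congˡ {x = ⟦ β ⟧} eb ⟩
      ⟦ β ⟧ * (t * g)                         ≈⟨ sym (*-assoc ⟦ β ⟧ t g) ⟩
      ⟦ β ⟧ * t * g                           ∎)
    (begin
      ⟦ β ⟧ * u * (s + ⟦ α ⟧ * t) + (v + - (u * ⟦ α ⟧)) * (⟦ β ⟧ * t)
        ≈⟨ solve 6 (λ β u s α t v → β :* u :* (s :+ α :* t) :+ (v :+ :- (u :* α)) :* (β :* t) := β :* (u :* s :+ v :* t)) refl
             ⟦ β ⟧ u s ⟦ α ⟧ t v ⟩
      ⟦ β ⟧ * (u * s + v * t)                 ≈⟨ *-congˡ {x = ⟦ β ⟧} e ⟩
      ⟦ β ⟧ * ⟦ M ⟧                           ≈⟨ sym (*-homo β M) ⟩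
      ⟦ β ℤ.* M ⟧                             ∎)

Bezout-resp : ∀ {a a′ b b′} → a ≋ a′ → b ≋ b′ → Bezout a b → Bezout a′ b′
Bezout-resp a≋ b≋ (bezout m M g s t u v m≢0 M≢0 ea eb e) = bezout m M g s t u v m≢0 M≢0
  (trans (*-congˡ {x = ⟦ m ⟧} (sym a≋)) ea) (trans (*-congˡ {x = ⟦ m ⟧} (sym b≋)) eb) e

-- b₀ a - a₀ b has constant coefficient 0; this is X times it.
eliminate : ℤ → Poly → ℤ → Poly → Poly
eliminate a₀ a b₀ b = scale b₀ a + scale (ℤ.- a₀) b

length-eliminate : ∀ a₀ a b₀ b → length b ℕ.≤ length a → length (eliminate a₀ a b₀ b) ≡ length a
length-eliminate a₀ []      b₀ []      h           = ≡.refl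
length-eliminate a₀ (x ∷ a) b₀ []      h           = ≡.cong suc (List.length-map (b₀ ℤ.*_) a)
length-eliminate a₀ (x ∷ a) b₀ (y ∷ b) (ℕ.s≤s h) = ≡.cong suc (length-eliminate a₀ a b₀ b h)

eliminate-≋ : ∀ a₀ a b₀ b → ⟦ b₀ ⟧ * (a₀ ∷ a) ≋ X * eliminate a₀ a b₀ b + ⟦ a₀ ⟧ * (b₀ ∷ b)
eliminate-≋ a₀ a b₀ b = begin
  ⟦ b₀ ⟧ * (a₀ ∷ a)
    ≈⟨ *-congˡ {x = ⟦ b₀ ⟧} (∷≋ a₀ a) ⟩
  ⟦ b₀ ⟧ * (⟦ a₀ ⟧ + X * a)
    ≈⟨ solve 5 (λ b₀ a₀ x a b → b₀ :* (a₀ :+ x :* a) := x :* (b₀ :* a :+ :- a₀ :* b) :+ a₀ :* (b₀ :+ x :* b)) refl ⟦ b₀ ⟧ ⟦ a₀ ⟧ X a b ⟩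
  X * (⟦ b₀ ⟧ * a + ⟦ ℤ.- a₀ ⟧ * b) + ⟦ a₀ ⟧ * (⟦ b₀ ⟧ + X * b)
    ≈⟨ +-cong (*-congˡ {x = X} (+-cong (constant-*P b₀ a) (constant-*P (ℤ.- a₀) b))) (*-congˡ {x = ⟦ a₀ ⟧} (sym (∷≋ b₀ b))) ⟩
  X * eliminate a₀ a b₀ b + ⟦ a₀ ⟧ * (b₀ ∷ b) ∎

0∷≋ : ∀ {a} p → a ≡ 0ℤ → X * p ≋ a ∷ p
0∷≋ p e = trans (sym (0∷≋X* p)) (∷-cong (≡.sym e) refl)

-- Euclid's algorithm, eliminating constant coefficients rather than leading ones.
Bezout-exists : ∀ n a b → length a ℕ.+ length b ℕ.≤ n → Bezout a b
Bezout-exists n a [] h = Bezout-0 a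
Bezout-exists n [] (b₀ ∷ b) h = Bezout-sym (Bezout-0 (b₀ ∷ b))
Bezout-exists (suc n) (a₀ ∷ a) (b₀ ∷ b) (ℕ.s≤s h) with a₀ ℤ.≟ 0ℤ | b₀ ℤ.≟ 0ℤ | ℕ.≤-total (length b) (length a)
... | yes a₀≡0 | yes b₀≡0 | _ = Bezout-resp (0∷≋ a a₀≡0) (0∷≋ b b₀≡0) (Bezout-X (Bezout-exists n a b
  (ℕ.≤-trans (ℕ.+-monoʳ-≤ (length a) (ℕ.n≤1+n (length b))) h)))
... | yes a₀≡0 | no b₀≢0  | _ = Bezout-resp (0∷≋ a a₀≡0) refl (Bezout-Xˡ b₀≢0 (Bezout-exists n a (b₀ ∷ b) h))
... | no a₀≢0  | yes b₀≡0 | _ = Bezout-sym (Bezout-resp (0∷≋ b b₀≡0) refl (Bezout-Xˡ a₀≢0 (Bezout-exists n b (a₀ ∷ a)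
  (ℕ.≤-trans (ℕ.≤-reflexive (ℕ.+-comm (length b) (suc (length a)))) (ℕ.≤-trans (ℕ.≤-reflexive (≡.sym (ℕ.+-suc (length a) (length b)))) h)))))
-- The longer list is the one replaced: the result is as long as its tail, so the total length
-- drops.
... | no a₀≢0  | no b₀≢0  | inj₁ b≤a = Bezout-combine a₀ b₀ b₀≢0 (eliminate-≋ a₀ a b₀ b)
  (Bezout-Xˡ b₀≢0 (Bezout-exists n (eliminate a₀ a b₀ b) (b₀ ∷ b)
    (≡.subst (λ k → k ℕ.+ suc (length b) ℕ.≤ n) (≡.sym (length-eliminate a₀ a b₀ b b≤a)) h)))
... | no a₀≢0  | no b₀≢0  | inj₂ a≤b = Bezout-sym (Bezout-combine b₀ a₀ a₀≢0 (eliminate-≋ b₀ b a₀ a)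
  (Bezout-Xˡ a₀≢0 (Bezout-exists n (eliminate b₀ b a₀ a) (a₀ ∷ a)
    (≡.subst (λ k → k ℕ.+ suc (length a) ℕ.≤ n) (≡.sym (length-eliminate b₀ b a₀ a a≤b))
      (ℕ.≤-trans (ℕ.≤-reflexive (ℕ.+-comm (length b) (suc (length a)))) (ℕ.≤-trans (ℕ.≤-reflexive (≡.sym (ℕ.+-suc (length a) (length b)))) h))))))

Primitive⇒≢0 : ∀ {f} → Primitive f → ¬ f ≋ zeroP
Primitive⇒≢0 {f} pf f≋0 with pf 0ℤ oneP ([] , sym (*-congʳ {x = oneP} f≋0))
... | c , coeffwise e with ≡.trans (≡.sym (≡.trans (coeff-0-* c ⟦ 0ℤ ⟧) (ℤ.*-zeroʳ (coeff c 0)))) (e 0)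
...   | ()

record Reduced (a b : Poly) : Set where
  constructor reduced
  field
    N D         : Poly
    primitive-D : Primitive D
    Nb≋aD       : N * b ≋ a * D
    coprime     : ∀ c → c ∣ N → c ∣ D → c ∣ oneP

-- Cancelling γ from m a = s g gives η a = s g′. As g′ divides the primitive b it is primitive, so η
-- divides s; with s = η s′ this yields a = s′ g′ and b = t′ g′.
reduce-split : ∀ {a b} → Primitive b → (B : Bezout a b) → Split (Bezout.m B) b (Bezout.t B) (Bezout.g B) → Reduced a b
reduce-split {a} {b} pb (bezout m M g s t u v m≢0 M≢0 ma≋sg _ us+vt≋M) (split η γ t′ g′ m≡ηγ t≋ g≋ t′g′≋) =
  conclude (Primitive-∣ {g′} {b} (t′ , t′g′≋) pb η s (a , torsionfree γ _ _ γ≢0 (begin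
    ⟦ γ ⟧ * (a * ⟦ η ⟧)       ≈⟨ solve 3 (λ γ a η → γ :* (a :* η) := η :* (γ :* a)) refl ⟦ γ ⟧ a ⟦ η ⟧ ⟩
    ⟦ η ⟧ * (⟦ γ ⟧ * a)       ≈⟨ trans (sym (⟦*⟧* η γ a)) (⟦⟧*-cong a (≡.sym m≡ηγ)) ⟩
    ⟦ m ⟧ * a                 ≈⟨ ma≋sg ⟩
    s * g                     ≈⟨ *-congˡ {x = s} g≋ ⟩
    s * (⟦ γ ⟧ * g′)          ≈⟨ solve 3 (λ s γ g → s :* (γ :* g) := γ :* (g :* s)) refl s ⟦ γ ⟧ g′ ⟩
    ⟦ γ ⟧ * (g′ * s)          ∎)))
  where
  γ≢0 : γ ≢ 0ℤ
  γ≢0 γ≡0 = m≢0 (≡.trans m≡ηγ (≡.trans (≡.cong (η ℤ.*_) γ≡0) (ℤ.*-zeroʳ η)))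
  primitive-t′ : Primitive t′
  primitive-t′ = Primitive-∣ {t′} {b} (g′ , trans (*-comm g′ t′) t′g′≋) pb

  conclude : ⟦ η ⟧ ∣ s → Reduced a b
  conclude (s′ , s′η≋s) = reduced s′ t′ primitive-t′ (begin
      s′ * b              ≈⟨ *-congˡ {x = s′} (sym t′g′≋) ⟩
      s′ * (t′ * g′)      ≈⟨ solve 3 (λ s t g → s :* (t :* g) := s :* g :* t) refl s′ t′ g′ ⟩
      s′ * g′ * t′        ≈⟨ *-congʳ {x = t′} (sym a≋s′g′) ⟩
      a * t′              ∎)
    coprime
    where
    a≋s′g′ : a ≋ s′ * g′
    a≋s′g′ = torsionfree m _ _ m≢0 (begin
      ⟦ m ⟧ * a                     ≈⟨ ma≋sg ⟩
      s * g                         ≈⟨ *-cong (sym s′η≋s) g≋ ⟩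
      s′ * ⟦ η ⟧ * (⟦ γ ⟧ * g′)     ≈⟨ solve 4 (λ s η γ g → s :* η :* (γ :* g) := η :* (γ :* (s :* g))) refl s′ ⟦ η ⟧ ⟦ γ ⟧ g′ ⟩
      ⟦ η ⟧ * (⟦ γ ⟧ * (s′ * g′))   ≈⟨ trans (sym (⟦*⟧* η γ (s′ * g′))) (⟦⟧*-cong (s′ * g′) (≡.sym m≡ηγ)) ⟩
      ⟦ m ⟧ * (s′ * g′)             ∎)

    coprime : ∀ c → c ∣ s′ → c ∣ t′ → c ∣ oneP
    coprime c c∣s′ c∣t′ =
      -- Up to here c is only a divisor of the integer `M`. Dividing the primitive t′, it is itself
      -- primitive, so `M` divides z in z c = M, and c is a unit.
      let z , zc≋M = c∣M
          z′ , z′M≋z = Primitive-∣ {c} {t′} c∣t′ primitive-t′ M z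
            (oneP , trans (*-identityˡ ⟦ M ⟧) (trans (sym zc≋M) (*-comm z c)))
      in z′ , torsionfree M _ _ M≢0 (begin
        ⟦ M ⟧ * (z′ * c)   ≈⟨ solve 3 (λ m z c → m :* (z :* c) := z :* m :* c) refl ⟦ M ⟧ z′ c ⟩
        z′ * ⟦ M ⟧ * c     ≈⟨ *-congʳ {x = c} z′M≋z ⟩
        z * c              ≈⟨ zc≋M ⟩
        ⟦ M ⟧              ≈⟨ sym (*-identityʳ ⟦ M ⟧) ⟩
        ⟦ M ⟧ * oneP       ∎)
      where
      assoc : ∀ u s → ⟦ η ⟧ * u * s ≋ u * (⟦ η ⟧ * s)
      assoc = solve 3 (λ η u s → η :* u :* s := u :* (η :* s)) refl ⟦ η ⟧
      s′η : ⟦ η ⟧ * s′ ≋ s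
      s′η = trans (*-comm ⟦ η ⟧ s′) s′η≋s
      c∣M : c ∣ ⟦ M ⟧
      c∣M = ∣-resp {c} refl (trans (+-cong (assoc u s′) (assoc v t′)) (trans (+-cong (*-congˡ {x = u} s′η) (*-congˡ {x = v} (sym t≋))) us+vt≋M))
        (∣m∣n⇒∣m+n {c} (∣n⇒∣m*n (⟦ η ⟧ * u) c∣s′) (∣n⇒∣m*n (⟦ η ⟧ * v) c∣t′))

reduce : ∀ a {b} → Primitive b → Reduced a b
reduce a {b} pb = reduce-split pb B (split-scalar (Bezout.m B) {b} (Bezout.m≢0 B) (Bezout.mb≋tg B))
  where
  B : Bezout a b
  B = Bezout-exists _ a b ℕ.≤-refl

-- Cyclotomic polynomials

properDivisors-∈⁺ : ∀ {d n} → 1 ℕ.≤ d → d ℕ.< n → d ℕ∣.∣ n → d ∈ properDivisors n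
properDivisors-∈⁺ {suc d} {suc n} _ (ℕ.s≤s d<n) d∣n = ∈-filter⁺ (ℕ∣._∣? suc n) (∈-map⁺ suc (∈-upTo⁺ d<n)) d∣n

properDivisors-∈⁻ : ∀ {d n} → d ∈ properDivisors n → 1 ℕ.≤ d × d ℕ.< n × d ℕ∣.∣ n
properDivisors-∈⁻ {d} {n} d∈ with ∈-filter⁻ (ℕ∣._∣? n) {v = d} {xs = map suc (upTo (n ℕ.∸ 1))} d∈
... | d∈′ , d∣n with ∈-map⁻ suc d∈′
...   | i , i∈ , ≡.refl = ℕ.s≤s ℕ.z≤n , suc<n n (∈-upTo⁻ i∈) , d∣n
  where
  suc<n : ∀ n → i ℕ.< n ℕ.∸ 1 → suc i ℕ.< n
  suc<n (suc n) h = ℕ.s≤s h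

properDivisors-unique : ∀ n → Unique (properDivisors n)
properDivisors-unique n = Unique.filter⁺ (ℕ∣._∣? n) (Unique.map⁺ ℕ.suc-injective (Unique.upTo⁺ (n ℕ.∸ 1)))

cycF-fuel : ∀ f g n → 1 ℕ.≤ n → n ℕ.≤ f → n ℕ.≤ g → cycF f n ≡ cycF g n
cycF-fuel zero    g       n 1≤n n≤0 n≤g = ⊥-elim (ℕ.<⇒≱ 1≤n n≤0)
cycF-fuel (suc f) zero    n 1≤n n≤f n≤0 = ⊥-elim (ℕ.<⇒≱ 1≤n n≤0)
cycF-fuel (suc f) (suc g) n 1≤n n≤f n≤g =
  ≡.cong (λ ps → divMonic (qpow n -P oneP) (prodP ps)) (List.map-cong-local (All.tabulate λ {d} d∈ →
    let 1≤d , d<n , _ = properDivisors-∈⁻ {d} {n} d∈ in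
    cycF-fuel f g d 1≤d (ℕ.≤-pred (ℕ.≤-trans d<n n≤f)) (ℕ.≤-pred (ℕ.≤-trans d<n n≤g))))

Φ-unfold : ∀ n → 1 ℕ.≤ n → Φ n ≡ divMonic (qpow n -P oneP) (prodP (map Φ (properDivisors n)))
Φ-unfold n@(suc n′) 1≤n = ≡.cong (λ ps → divMonic (qpow n -P oneP) (prodP ps))
  (List.map-cong-local (All.tabulate λ {d} d∈ →
    let 1≤d , d<n , _ = properDivisors-∈⁻ {d} {n} d∈ in cycF-fuel n′ d d 1≤d (ℕ.≤-pred d<n) ℕ.≤-refl))

Primitive-1-X^ : ∀ n → 1 ℕ.≤ n → Primitive (oneP - X ^ n)
Primitive-1-X^ (suc n) _ = Primitive-resp {1ℤ ∷ - (X ^ n)} {oneP - X ^ suc n} (begin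
  1ℤ ∷ - (X ^ n)           ≈⟨ ∷≋ 1ℤ (- (X ^ n)) ⟩
  oneP + X * - (X ^ n)     ≈⟨ +-congˡ {x = oneP} (solve 2 (λ x p → x :* :- p := :- (x :* p)) refl X (X ^ n)) ⟩
  oneP - X ^ suc n         ∎) (Primitive-1∷ (- (X ^ n)))

Primitive-X^-1 : ∀ n → 1 ℕ.≤ n → Primitive (X ^ n - oneP)
Primitive-X^-1 n 1≤n = Primitive-resp { - (oneP - X ^ n)} {X ^ n - oneP}
  (solve 2 (λ o x → :- (o :- x) := x :- o) refl oneP (X ^ n)) (Primitive-neg {oneP - X ^ n} (Primitive-1-X^ n 1≤n))

Primitive-cancel : ∀ {f} x y → Primitive f → f * x ≋ f * y → x ≋ y
Primitive-cancel {f} x y pf e =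
  let c , e′ = pf 0ℤ (x - y) (zeroP , sym (begin
        f * (x - y)      ≈⟨ solve 3 (λ f x y → f :* (x :- y) := f :* x :- f :* y) refl f x y ⟩
        f * x - f * y    ≈⟨ trans (+-congʳ {x = - (f * y)} e) (x-x≈0 (f * y)) ⟩
        zeroP            ∎))
  in x-y≈0⇒x≈y (trans (sym e′) (trans (*-congˡ {x = c} 0-homo) (zeroʳ c)))

∈⇒∣prodP : ∀ (F : ℕ → Poly) {d ds} → d ∈ ds → F d ∣ prodP (map F ds)
∈⇒∣prodP F {d} {_ ∷ ds} (here ≡.refl) = prodP (map F ds) , *-comm (prodP (map F ds)) (F d)
∈⇒∣prodP F {d} {e ∷ ds} (there d∈)    = ∣n⇒∣m*n {F d} (F e) (∈⇒∣prodP F d∈)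

-- Dividing x by one factor keeps it divisible by the others, since those are comaximal with it.
prodP∣ : ∀ (F : ℕ → Poly) {x} ds → Unique ds → (∀ {d} → d ∈ ds → Primitive (F d)) → (∀ {d} → d ∈ ds → F d ∣ x) →
  (∀ {d e} → d ∈ ds → e ∈ ds → d ≢ e → Comaximal (F d) (F e)) → prodP (map F ds) ∣ x
prodP∣ F {x} []       _           p h c = x , *-identityʳ x
prodP∣ F {x} (d ∷ ds) (d∉ ∷ uds) p h c =
  let y , yF≋x = h (here ≡.refl)
      z , zP≋y = prodP∣ F {y} ds uds (λ e∈ → p (there e∈))
        (λ {e} e∈ → comaximal⇒cancellable torsionfree {F e} {F d} (p (there e∈))
          (c (there e∈) (here ≡.refl) (λ e≡d → All.lookup d∉ e∈ (≡.sym e≡d)))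
          y (∣-resp {F e} refl (sym yF≋x) (h (there e∈))))
        (λ d∈ e∈ → c (there d∈) (there e∈))
  in z , (begin
    z * (F d * P)   ≈⟨ solve 3 (λ z f p → z :* (f :* p) := z :* p :* f) refl z (F d) P ⟩
    z * P * F d     ≈⟨ *-congʳ {x = F d} zP≋y ⟩
    y * F d         ≈⟨ yF≋x ⟩
    x               ∎)
  where
  P = prodP (map F ds)

prodP-closed : (P : Poly → Set) → P oneP → (∀ {p q} → P p → P q → P (p * q)) →
  ∀ (F : ℕ → Poly) ds → (∀ {d} → d ∈ ds → P (F d)) → P (prodP (map F ds))
prodP-closed P P1 P* F []       h = P1
prodP-closed P P1 P* F (d ∷ ds) h = P* (h (here ≡.refl)) (prodP-closed P P1 P* F ds (λ d∈ → h (there d∈)))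

-- The statement carried by strong induction. Comaximality rests on `cofactor`: the quotient (X^n -
-- 1)/(X^g - 1) is still a multiple of Φ_n for every proper divisor g of n.
record Cyclotomic (n : ℕ) : Set where
  field
    divisor  : Φ n ∣ X ^ n - oneP
    product  : Φ n * prodP (map Φ (properDivisors n)) ≋ X ^ n - oneP
    monic    : Monic (Φ n)
    cofactor : ∀ g k → 1 ℕ.< k → n ≡ k ℕ.* g → Φ n ∣ geometric (X ^ g) k

  primitive-Φ : 1 ℕ.≤ n → Primitive (Φ n)
  primitive-Φ 1≤n = Primitive-∣ {Φ n} {X ^ n - oneP} divisor (Primitive-X^-1 n 1≤n)

  -- Modulo Φ n and X^m - 1 also X^gcd(n,m) = 1, whence 0 = (X^n - 1)/(X^gcd(n,m) - 1) = n/gcd(n,m).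
  comaximal : 1 ℕ.≤ n → ∀ m → ¬ n ℕ∣.∣ m → Comaximal (Φ n) (X ^ m - oneP)
  comaximal 1≤n m n∤m = go (ℕ∣.quotient g∣n) (ℕ∣._∣_.equality g∣n) (1<k (ℕ∣.quotient g∣n) (ℕ∣._∣_.equality g∣n))
    where
    g∣n = gcd[m,n]∣m n m
    g = gcd n m
    V = X ^ m - oneP

    1<k : ∀ k → n ≡ k ℕ.* g → 1 ℕ.< k
    1<k zero          n≡0  = ⊥-elim (ℕ.<⇒≢ 1≤n (≡.sym n≡0))
    -- Quotient 1 would mean gcd(n, m) = n, that is, n divides m.
    1<k (suc zero)    n≡g  = ⊥-elim (n∤m (≡.subst (ℕ∣._∣ m) (≡.sym (≡.trans n≡g (ℕ.+-identityʳ g))) (gcd[m,n]∣n n m)))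
    1<k (suc (suc k)) _    = ℕ.s≤s (ℕ.s≤s ℕ.z≤n)

    go : ∀ k → n ≡ k ℕ.* g → 1 ℕ.< k → Comaximal (Φ n) V
    go k@(suc _) n≡kg 1<k =
      let y , yΦ≋ = cofactor g k 1<k n≡kg
          z , geometric≋ = geometric≡n (X ^ g) k
          α , β , U≋ = x^gcd-1 X n m
          γ , γΦ≋ = divisor
      in ℤ.+ k , y + - (z * α * γ) , - (z * β) , (λ ()) , (begin
        (y + - (z * α * γ)) * Φ n + - (z * β) * V
          ≈⟨ solve 7 (λ y z α γ φ β v → (y :+ :- (z :* α :* γ)) :* φ :+ :- (z :* β) :* v := y :* φ :- z :* (α :* (γ :* φ) :+ β :* v)) refl
               y z α γ (Φ n) β V ⟩
        y * Φ n - z * (α * (γ * Φ n) + β * V)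
          ≈⟨ +-cong yΦ≋ (-‿cong (*-congˡ {x = z} (trans (+-congʳ {x = β * V} (*-congˡ {x = α} γΦ≋)) U≋))) ⟩
        geometric (X ^ g) k - z * (X ^ g - oneP)
          ≈⟨ +-congʳ {x = - (z * (X ^ g - oneP))} geometric≋ ⟩
        ⟦ ℤ.+ k ⟧ + (X ^ g - oneP) * z - z * (X ^ g - oneP)
          ≈⟨ solve 3 (λ k u z → k :+ u :* z :- z :* u := k) refl ⟦ ℤ.+ k ⟧ (X ^ g - oneP) z ⟩
        ⟦ ℤ.+ k ⟧ ∎)

cyclotomic : ∀ n → 1 ℕ.≤ n → Cyclotomic n
cyclotomic = <-rec (λ n → 1 ℕ.≤ n → Cyclotomic n) step
  where
  step : ∀ n → (∀ {d} → d ℕ.< n → 1 ℕ.≤ d → Cyclotomic d) → 1 ℕ.≤ n → Cyclotomic n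
  step n rec 1≤n = record
    { divisor  = D , trans (*-comm D (Φ n)) product
    ; product  = product
    ; monic    = Monic-resp (sym Φ≋C) monic-C
    ; cofactor = cofactor
    }
    where
    D = prodP (map Φ (properDivisors n))

    lower : ∀ {d} → d ∈ properDivisors n → 1 ℕ.≤ d × d ℕ.< n × d ℕ∣.∣ n × Cyclotomic d
    lower d∈ = let 1≤d , d<n , d∣n = properDivisors-∈⁻ {n = n} d∈ in 1≤d , d<n , d∣n , rec d<n 1≤d

    primitive-Φ : ∀ {d} → d ∈ properDivisors n → Primitive (Φ d)
    primitive-Φ d∈ = let 1≤d , _ , _ , cd = lower d∈ in Cyclotomic.primitive-Φ cd 1≤d

    -- Distinct d and e do not divide each other in both directions. If d does not divide e, then
    -- Φ_d is comaximal with X^e - 1, a multiple of Φ_e; otherwise the roles are exchanged.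
    comaximal : ∀ {d e} → d ∈ properDivisors n → e ∈ properDivisors n → d ≢ e → Comaximal (Φ d) (Φ e)
    comaximal {d} {e} d∈ e∈ d≢e = go (lower d∈) (lower e∈) (d ℕ∣.∣? e)
      where
      go : 1 ℕ.≤ d × d ℕ.< n × d ℕ∣.∣ n × Cyclotomic d → 1 ℕ.≤ e × e ℕ.< n × e ℕ∣.∣ n × Cyclotomic e →
           Dec (d ℕ∣.∣ e) → Comaximal (Φ d) (Φ e)
      go (1≤d , _ , _ , cd) (_ , _ , _ , ce) (no d∤e) =
        Comaximal-∣ {Φ d} {Φ e} {X ^ e - oneP} (Cyclotomic.divisor ce) (Cyclotomic.comaximal cd 1≤d e d∤e)
      go (_ , _ , _ , cd) (1≤e , _ , _ , ce) (yes d∣e) =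
        Comaximal-sym {Φ e} {Φ d} (Comaximal-∣ {Φ e} {Φ d} {X ^ d - oneP} (Cyclotomic.divisor cd)
          (Cyclotomic.comaximal ce 1≤e d (λ e∣d → d≢e (ℕ∣.∣-antisym d∣e e∣d))))

    D∣X^n-1 : D ∣ X ^ n - oneP
    D∣X^n-1 = prodP∣ Φ (properDivisors n) (properDivisors-unique n) primitive-Φ divides comaximal
      where
      divides : ∀ {d} → d ∈ properDivisors n → Φ d ∣ X ^ n - oneP
      divides {d} d∈ = let _ , _ , d∣n , cd = lower d∈ in ∣-trans {Φ d} {X ^ d - oneP} (Cyclotomic.divisor cd) (x^m-1∣x^n-1 X d∣n)

    C : Poly
    C = proj₁ D∣X^n-1

    monic-D : Monic D
    monic-D = prodP-closed Monic Monic-1 Monic-* Φ (properDivisors n) λ d∈ → Cyclotomic.monic (proj₂ (proj₂ (proj₂ (lower d∈))))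

    q^n-1≋ : X ^ n - oneP ≋ qpow n -P oneP
    q^n-1≋ = +-congʳ {x = - oneP} (sym (qpow≋X^ n))

    monic-q^n-1 : Monic (qpow n -P oneP)
    monic-q^n-1 = Monic-resp q^n-1≋ (≡.subst (λ n → Monic (X ^ n - oneP)) (ℕ.suc-pred n {{ℕ.>-nonZero 1≤n}}) (Monic-X^n-1 (ℕ.pred n)))

    exact : divMonic (qpow n -P oneP) D ≋ C × Monic C
    exact = divMonic-exact {d = D} monic-q^n-1 monic-D (trans (proj₂ D∣X^n-1) q^n-1≋)

    monic-C : Monic C
    monic-C = proj₂ exact

    Φ≋C : Φ n ≋ C
    Φ≋C = trans (reflexive (Φ-unfold n 1≤n)) (proj₁ exact)

    product : Φ n * D ≋ X ^ n - oneP
    product = trans (*-congʳ {x = D} Φ≋C) (proj₂ D∣X^n-1)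

    -- X^g - 1 is the product of Φ_e over all divisors e of g. These are proper divisors of n, so it
    -- divides `D`, and cancelling it from Φ_n D = X^n - 1 leaves the geometric sum.
    cofactor : ∀ g k → 1 ℕ.< k → n ≡ k ℕ.* g → Φ n ∣ geometric (X ^ g) k
    cofactor g k 1<k n≡kg = conclude (prodP∣ Φ {D} (g ∷ properDivisors g) g∷unique (λ d∈ → primitive-Φ (divisors d∈))
        (λ d∈ → ∈⇒∣prodP Φ (divisors d∈)) (λ d∈ e∈ → comaximal (divisors d∈) (divisors e∈)))
      where
      1≤g : 1 ℕ.≤ g
      1≤g = ℕ.n≢0⇒n>0 λ g≡0 → ℕ.<⇒≢ 1≤n (≡.sym (≡.trans n≡kg (≡.trans (≡.cong (k ℕ.*_) g≡0) (ℕ.*-zeroʳ k))))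
      g<n : g ℕ.< n
      g<n = ≡.subst (g ℕ.<_) (≡.trans (ℕ.*-comm g k) (≡.sym n≡kg)) (ℕ.m<m*n g k {{ℕ.>-nonZero 1≤g}} 1<k)
      divisors : ∀ {d} → d ∈ g ∷ properDivisors g → d ∈ properDivisors n
      divisors (here ≡.refl) = properDivisors-∈⁺ 1≤g g<n (ℕ∣.divides k n≡kg)
      divisors (there d∈) with properDivisors-∈⁻ {n = g} d∈
      ... | 1≤d , d<g , d∣g = properDivisors-∈⁺ 1≤d (ℕ.<-trans d<g g<n) (ℕ∣.∣-trans d∣g (ℕ∣.divides k n≡kg))
      g∷unique : Unique (g ∷ properDivisors g)
      g∷unique = All.tabulate (λ d∈ g≡d → ℕ.<⇒≢ (proj₁ (proj₂ (properDivisors-∈⁻ {n = g} d∈))) (≡.sym g≡d)) ∷ properDivisors-unique g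
      P = prodP (map Φ (properDivisors g))
      conclude : Φ g * P ∣ D → Φ n ∣ geometric (X ^ g) k
      conclude (y , yP≋D) = y , Primitive-cancel {X ^ g - oneP} _ _ (Primitive-X^-1 g 1≤g) (begin
        (X ^ g - oneP) * (y * Φ n)
          ≈⟨ *-congʳ {x = y * Φ n} (sym (Cyclotomic.product (rec g<n 1≤g))) ⟩
        Φ g * P * (y * Φ n)
          ≈⟨ solve 4 (λ f p y φ → f :* p :* (y :* φ) := φ :* (y :* (f :* p))) refl (Φ g) P y (Φ n) ⟩
        Φ n * (y * (Φ g * P))
          ≈⟨ trans (*-congˡ {x = Φ n} yP≋D) product ⟩
        X ^ n - oneP
          ≈⟨ +-congʳ {x = - oneP} (trans (reflexive (≡.cong (X ^_) (≡.trans n≡kg (ℕ.*-comm k g)))) (sym (^-assocʳ X g k))) ⟩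
        (X ^ g) ^ k - oneP
          ≈⟨ sym (geometric-telescopes (X ^ g) k) ⟩
        (X ^ g - oneP) * geometric (X ^ g) k ∎)

-- The congruences

powP-closed : (P : Poly → Set) → P oneP → (∀ {p q} → P p → P q → P (p * q)) → ∀ {p} n → P p → P (powP p n)
powP-closed P P1 P* zero    h = P1
powP-closed P P1 P* (suc n) h = P* h (powP-closed P P1 P* n h)

den-sumR-closed : (P : Poly → Set) → P oneP → (∀ {p q} → P p → P q → P (p * q)) →
  ∀ (f : ℕ → RatF) ds → (∀ {d} → d ∈ ds → P (den (f d))) → P (den (sumR (map f ds)))
den-sumR-closed P P1 P* f []       h = P1
den-sumR-closed P P1 P* f (d ∷ ds) h = P* (h (here ≡.refl)) (den-sumR-closed P P1 P* f ds (λ d∈ → h (there d∈)))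

den∣den-sumR : ∀ (f : ℕ → RatF) {d ds} → d ∈ ds → den (f d) ∣ den (sumR (map f ds))
den∣den-sumR f {d} {_ ∷ ds} (here ≡.refl) = den (sumR (map f ds)) , *-comm (den (sumR (map f ds))) (den (f d))
den∣den-sumR f {d} {e ∷ ds} (there d∈)    = ∣n⇒∣m*n {den (f d)} (den (f e)) (den∣den-sumR f d∈)

-- `poch` unfolds at its first factor, whereas `pochhammer` recurses at the last one.
poch-suc : ∀ a b k → poch a b (suc k) ≋ poch a b k * (oneP -P qpow (a ℕ.+ b ℕ.* k))
poch-suc a b k = trans (reflexive (≡.cong (λ ks → prodP (map F ks)) (≡.sym (List.upTo-∷ʳ k)))) (snoc (upTo k))
  where
  F : ℕ → Poly
  F j = oneP -P qpow (a ℕ.+ b ℕ.* j)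
  snoc : ∀ ds → prodP (map F (ds ++ k ∷ [])) ≋ prodP (map F ds) * F k
  snoc []       = *-comm (F k) oneP
  snoc (d ∷ ds) = trans (*-congˡ {x = F d} (snoc ds)) (sym (*-assoc (F d) (prodP (map F ds)) (F k)))

∣P⇒∣ : ∀ {p q} → p ∣P q → p ∣ q
∣P⇒∣ (c , e) = c , ≈P⇒≋ e

∣⇒∣P : ∀ {p q} → p ∣ q → p ∣P q
∣⇒∣P (c , e) = c , ≋⇒≈P e

-- Reduction cannot lose `P`: it divides num S, hence N den S = num S D, and den S cancels modulo
-- `P`.
≡0-mod : ∀ {P} S → Primitive (den S) → Cancellable[ P ] (den S) → P ∣ num S → S ≡R polyR zeroP mod P
≡0-mod {P} S primitive-den cancellable P∣num = from-reduced
  (reduce (num (S -R polyR zeroP)) (Primitive-resp (sym (*-identityʳ (den S))) primitive-den))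
  where
  difference : num (S -R polyR zeroP) ≋ num S
  difference = trans (+-identityʳ (num S * oneP)) (*-identityʳ (num S))

  from-reduced : Reduced (num (S -R polyR zeroP)) (den (S -R polyR zeroP)) → S ≡R polyR zeroP mod P
  from-reduced (reduced N D primitive-D Nb≋aD coprime) = N , D ,
    ( (λ D≡0 → Primitive⇒≢0 {D} primitive-D (coeffwise (IsZeroP⇒coeff≡0 D≡0)))
    , ≋⇒≈P Nb≋aD
    , (λ c c∣N c∣D → ∣⇒∣P {c} (coprime c (∣P⇒∣ {c} c∣N) (∣P⇒∣ {c} c∣D))))
    , ∣⇒∣P {P} (cancellable N (∣-resp {P} refl (trans (sym Nb≋aD) (*-congˡ {x = N} (*-identityʳ (den S))))
        (∣m⇒∣m*n {P} D (∣-resp {P} refl (sym difference) P∣num))))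

-- The three sums modulo Φ_n, here an abstract polynomial `P`

module Congruence (m : ℕ) (P : Poly) (primitive-P : Primitive P)
  (P∣X^n-1 : P ∣ X ^ (1 ℕ.+ 3 ℕ.* m) - oneP) (P∣geometric : P ∣ geometric X (1 ℕ.+ 3 ℕ.* m))
  (comaximal : ∀ k → ¬ 1 ℕ.+ 3 ℕ.* m ℕ∣.∣ k → Comaximal P (X ^ k - oneP)) where

  private
    n = 1 ℕ.+ 3 ℕ.* m

  Q = quotientRing polyRing constantAlgebra (P)
  ιQ = quotientAlgebra polyRing constantAlgebra (P)
  module Q = Algebraic Q ιQ

  lift : ∀ {p q} → p ≋ q → p Q.≈ q
  lift = ≈⇒congruent polyRing constantAlgebra (P)

  ≈0⇒∣ : ∀ {p} → p Q.≈ zeroP → P ∣ p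
  ≈0⇒∣ {p} (congruent d) = ∣-resp {P} refl (+-identityʳ p) d

  ∣⇒≈0 : ∀ {p} → P ∣ p → p Q.≈ zeroP
  ∣⇒≈0 {p} d = congruent (∣-resp {P} refl (sym (+-identityʳ p)) d)

  ^≡^ : ∀ k → X ^ k ≡ X Q.^ k
  ^≡^ zero    = ≡.refl
  ^≡^ (suc k) = ≡.cong (X *_) (^≡^ k)

  geometric≡geometric : ∀ k → geometric X k ≡ Q.geometric X k
  geometric≡geometric zero    = ≡.refl
  geometric≡geometric (suc k) = ≡.cong (λ g → oneP + X * g) (geometric≡geometric k)

  X^n≈1 : X Q.^ n Q.≈ oneP
  X^n≈1 = Q.trans (Q.reflexive (≡.sym (^≡^ n))) (congruent P∣X^n-1)

  geometric≈0 : Q.geometric X n Q.≈ zeroP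
  geometric≈0 = Q.trans (Q.reflexive (≡.sym (geometric≡geometric n))) (∣⇒≈0 P∣geometric)

  open RootOfUnity Q ιQ X m X^n≈1 geometric≈0

  qpow≈ : ∀ k → qpow k Q.≈ X Q.^ k
  qpow≈ k = Q.trans (lift (qpow≋X^ k)) (Q.reflexive (^≡^ k))

  qint≈ : ∀ k → qint k Q.≈ Q.geometric X k
  qint≈ zero    = Q.refl
  qint≈ (suc k) = Q.trans (lift (∷≋ 1ℤ (qint k))) (Q.+-congˡ {x = oneP} (Q.*-congˡ {x = X} (qint≈ k)))

  powP≈ : ∀ {p r} k → p Q.≈ r → powP p k Q.≈ r Q.^ k
  powP≈ zero    e = Q.refl
  powP≈ (suc k) e = Q.*-cong e (powP≈ k e)

  poch≈ : ∀ a k → poch a 3 k Q.≈ pochhammer a k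
  poch≈ a zero    = Q.refl
  poch≈ a (suc k) = Q.trans (lift (poch-suc a 3 k))
    (Q.*-cong (poch≈ a k) (Q.+-congˡ {x = oneP} (Q.-‿cong (qpow≈ (a ℕ.+ 3 ℕ.* k)))))

  termNum≈ : ∀ e k → termNum e k Q.≈ Q.geometric X (6 ℕ.* k ℕ.+ 1) * pochhammer 1 k Q.^ e * pochhammer 3 (2 ℕ.* k)
  termNum≈ e k = Q.*-cong (Q.*-cong (qint≈ (6 ℕ.* k ℕ.+ 1)) (powP≈ e (poch≈ 1 k))) (poch≈ 3 (2 ℕ.* k))

  termDen≈ : ∀ e k → termDen e k Q.≈ pochhammer 3 k Q.^ e * pochhammer 2 (2 ℕ.* k)
  termDen≈ e k = Q.*-cong (powP≈ e (poch≈ 3 k)) (poch≈ 2 (2 ℕ.* k))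

  -- What a denominator must satisfy: primitivity serves the reduction of the fraction,
  -- cancellability the divisibility of its numerator. Both are multiplicative.
  record Regular (p : Poly) : Set where
    constructor regular
    field
      primitive-p   : Primitive p
      cancellable-p : Cancellable[ P ] p

  Regular-1 : Regular oneP
  Regular-1 = regular Primitive-1 Cancellable-1

  Regular-* : ∀ {p q} → Regular p → Regular q → Regular (p * q)
  Regular-* {p} {q} (regular a b) (regular c d) = regular (Primitive-* {p} {q} a c) (Cancellable-* {P} {p} {q} b d)

  Regular-resp : ∀ {p q} → p ≋ q → Regular p → Regular q
  Regular-resp e (regular a b) = regular (Primitive-resp e a) (Cancellable-resp {P} e b)

  Regular-qpow : ∀ k → Regular (qpow k)
  Regular-qpow zero    = Regular-1
  Regular-qpow (suc k) = Regular-resp (sym (0∷≋X* (qpow k)))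
    -- X is a unit modulo `P` with inverse X^(3m), as X^n is congruent to 1.
    (Regular-* {X} {qpow k} (regular Primitive-X (Cancellable-unit {P} X (X ^ (3 ℕ.* m)) P∣X^n-1)) (Regular-qpow k))

  Regular-1-qpow : ∀ k → 1 ℕ.≤ k → ¬ n ℕ∣.∣ k → Regular (oneP -P qpow k)
  Regular-1-qpow k 1≤k n∤k = Regular-resp {oneP - X ^ k} (+-congˡ {x = oneP} (-‿cong (sym (qpow≋X^ k))))
    (regular (Primitive-1-X^ k 1≤k) (Cancellable-resp {P} {negP (X ^ k - oneP)}
      (solve 2 (λ o x → :- (x :- o) := o :- x) refl oneP (X ^ k))
      (Cancellable-neg {P} {X ^ k - oneP} (comaximal⇒cancellable torsionfree {P} {X ^ k - oneP} primitive-P (comaximal k n∤k)))))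

  Regular-poch : ∀ a k → 1 ℕ.≤ a → (∀ j → j ℕ.< k → ¬ n ℕ∣.∣ a ℕ.+ 3 ℕ.* j) → Regular (poch a 3 k)
  Regular-poch a k 1≤a h = prodP-closed Regular Regular-1 Regular-* (λ j → oneP -P qpow (a ℕ.+ 3 ℕ.* j)) (upTo k)
    (λ {j} j∈ → Regular-1-qpow (a ℕ.+ 3 ℕ.* j) (ℕ.≤-trans 1≤a (ℕ.m≤m+n a (3 ℕ.* j))) (h j (∈-upTo⁻ j∈)))

  Regular-termDen : ∀ e k → k ℕ.≤ m → Regular (termDen e k)
  Regular-termDen e k k≤m = Regular-* {powP (poch 3 3 k) e} {poch 2 3 (2 ℕ.* k)}
    (powP-closed Regular Regular-1 Regular-* e (Regular-poch 3 k (ℕ.s≤s ℕ.z≤n) n∤3+3j))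
    (Regular-poch 2 (2 ℕ.* k) (ℕ.s≤s ℕ.z≤n) n∤2+3j)
    where
    n∤3+3j : ∀ j → j ℕ.< k → ¬ n ℕ∣.∣ 3 ℕ.+ 3 ℕ.* j
    n∤3+3j j j<k n∣ = ℕ.<⇒≱ (ℕ.s≤s (≡.subst (ℕ._≤ 3 ℕ.* m) (ℕ.*-suc 3 j) (ℕ.*-monoʳ-≤ 3 (ℕ.≤-trans j<k k≤m)))) (ℕ∣.∣⇒≤ n∣)

    -- Being positive and less than 2n, this number could only be n itself, but the residues modulo
    -- 3 are 2 and 1.
    n∤2+3j : ∀ j → j ℕ.< 2 ℕ.* k → ¬ n ℕ∣.∣ 2 ℕ.+ 3 ℕ.* j
    n∤2+3j j j<2k (ℕ∣.divides c e) = quotient c e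
      where
      mod-3 : ∀ r s → (r ℕ.+ 3 ℕ.* s) % 3 ≡ r % 3
      mod-3 r s = ≡.trans (≡.cong (λ t → (r ℕ.+ t) % 3) (ℕ.*-comm 3 s)) (ℕ.[m+kn]%n≡m%n r s 3)
      bound : 2 ℕ.+ 3 ℕ.* j ℕ.< 2 ℕ.* n
      bound = ℕ.<-≤-trans (ℕ.+-monoʳ-< 2 (ℕ.*-monoʳ-< 3 (ℕ.<-≤-trans j<2k (ℕ.*-monoʳ-≤ 2 k≤m)))) (ℕ.≤-reflexive (expand m))
        where
        expand : ∀ m → 2 ℕ.+ 3 ℕ.* (2 ℕ.* m) ≡ 2 ℕ.* (1 ℕ.+ 3 ℕ.* m)
        expand = solve-∀
      2≢1 : 2 ≢ 1
      2≢1 ()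
      quotient : ∀ c → ¬ 2 ℕ.+ 3 ℕ.* j ≡ c ℕ.* n
      quotient zero          ()
      quotient (suc zero)    e = 2≢1 (≡.trans (≡.sym (mod-3 2 j)) (≡.trans (≡.cong (_% 3) (≡.trans e (ℕ.+-identityʳ n))) (mod-3 1 m)))
      quotient (suc (suc c)) e = ℕ.<⇒≱ bound (≡.subst (2 ℕ.* n ℕ.≤_) (≡.sym e) (ℕ.*-monoˡ-≤ n {2} {suc (suc c)} (ℕ.s≤s (ℕ.s≤s ℕ.z≤n))))

  module _ (f : ℕ → RatF) (regular-den : ∀ k → k ℕ.≤ m → Regular (den (f k)))
    (opposite-terms : ∀ k l → k ℕ.+ l ≡ m → num (f k) * den (f l) + num (f l) * den (f k) Q.≈ zeroP) where
    private
      S = sumR (map f (upTo (suc m)))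
      B = den S

      regular-B : Regular B
      regular-B = den-sumR-closed Regular Regular-1 Regular-* f (upTo (suc m))
        (λ {k} k∈ → regular-den k (ℕ.≤-pred (∈-upTo⁻ k∈)))

      divides-B : ∀ (i : Fin (suc m)) → den (f (toℕ i)) ∣ B
      divides-B i = den∣den-sumR f (∈-applyUpTo⁺ id (Fin.toℕ<n i))

      -- The i-th term of the sum multiplied by the common denominator `B`, so that terms can be
      -- added as polynomials.
      α : Fin (suc m) → Poly
      α i = num (f (toℕ i)) * proj₁ (divides-B i)

      α-fraction : ∀ i → den (f (toℕ i)) * α i ≋ num (f (toℕ i)) * B
      α-fraction i = trans (solve 3 (λ d a b → d :* (a :* b) := a :* (b :* d)) refl (den (f (toℕ i))) (num (f (toℕ i))) (proj₁ (divides-B i)))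
        (*-congˡ {x = num (f (toℕ i))} (proj₂ (divides-B i)))

      -- General in `g` because `applyUpTo` shifts its index function at each recursive call.
      sum-fraction : ∀ k (g : ℕ → ℕ) (α : Fin k → Poly) →
        (∀ i → den (f (g (toℕ i))) * α i ≋ num (f (g (toℕ i))) * B) →
        den (sumR (map f (applyUpTo g k))) * sum α ≋ num (sumR (map f (applyUpTo g k))) * B
      sum-fraction zero    g α h = zeroʳ oneP
      sum-fraction (suc k) g α h = fraction-+ {num (f (g 0))} {den (f (g 0))} {num S′} {den S′} B (h Fin.zero)
        (sum-fraction k (λ j → g (suc j)) (λ i → α (Fin.suc i)) (λ i → h (Fin.suc i)))
        where
        S′ = sumR (map f (applyUpTo (λ j → g (suc j)) k))

      toℕ+opposite : ∀ (i : Fin (suc m)) → toℕ i ℕ.+ toℕ (opposite i) ≡ m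
      toℕ+opposite i = ≡.trans (≡.cong (toℕ i ℕ.+_) (Fin.opposite-prop i)) (ℕ.m+[n∸m]≡n (Fin.toℕ≤pred[n] i))

      regular-den-toℕ : ∀ i → Regular (den (f (toℕ {suc m} i)))
      regular-den-toℕ i = regular-den (toℕ i) (Fin.toℕ≤pred[n] i)

      α-antisymmetric : ∀ i → α i + α (opposite i) Q.≈ zeroP
      α-antisymmetric i = ∣⇒≈0 (Regular.cancellable-p
        (Regular-* {den (f (toℕ i))} {den (f (toℕ (opposite i)))} (regular-den-toℕ i) (regular-den-toℕ (opposite i)))
        (α i + α (opposite i))
        (≈0⇒∣ (Q.opposite-fractions {num (f (toℕ i))} {den (f (toℕ i))} {num (f (toℕ (opposite i)))} {den (f (toℕ (opposite i)))}
          B (lift (α-fraction i)) (lift (α-fraction (opposite i))) (opposite-terms (toℕ i) (toℕ (opposite i)) (toℕ+opposite i)))))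

      sum≡sum : ∀ {k} (α : Fin k → Poly) → sum α ≡ Q.sum α
      sum≡sum {zero}  α = ≡.refl
      sum≡sum {suc k} α = ≡.cong (α Fin.zero +_) (sum≡sum (λ i → α (Fin.suc i)))

      P∣sum : P ∣ sum α
      -- A middle index is its own opposite, so the pairing controls only the doubled sum;
      -- primitivity of `P` cancels the 2.
      P∣sum = ⟦M⟧-cancellable torsionfree {P} primitive-P (ℤ.+ 2) (λ ()) (sum α)
        (∣-resp {P} refl twice (≈0⇒∣ (Q.antisymmetric-sum α α-antisymmetric)))
        where
        twice : Q.sum α + Q.sum α ≋ sum α * ⟦ ℤ.+ 2 ⟧
        twice = trans (reflexive (≡.cong (λ s → s + s) (≡.sym (sum≡sum α))))
          (solve 1 (λ s → s :+ s := s :* con (ℤ.+ 2)) refl (sum α))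

      P∣num : P ∣ num S
      P∣num = Regular.cancellable-p regular-B (num S)
        (∣-resp {P} refl (trans (*-comm (sum α) B) (sum-fraction (suc m) id α α-fraction)) (∣m⇒∣m*n {P} B P∣sum))

    sum≡0 : S ≡R polyR zeroP mod P
    sum≡0 = ≡0-mod S (Regular.primitive-p regular-B) (Regular.cancellable-p regular-B) P∣num

  cross : ∀ {a a′ b b′ c c′ d d′} → a Q.≈ a′ → b Q.≈ b′ → c Q.≈ c′ → d Q.≈ d′ →
    a′ * d′ + c′ * b′ Q.≈ zeroP → a * d + c * b Q.≈ zeroP
  cross a b c d e = Q.trans (Q.+-cong (Q.*-cong a d) (Q.*-cong c b)) e

  first : sumR (map (λ k → (termNum 6 k *P qpow (2 ℕ.* k)) / termDen 6 k) (upTo (suc m))) ≡R polyR zeroP mod P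
  first = sum≡0 (λ k → (termNum 6 k *P qpow (2 ℕ.* k)) / termDen 6 k) (λ k k≤m → Regular-termDen 6 k k≤m)
    (λ k l e → cross (num≈ k) (den≈ k) (num≈ l) (den≈ l) (terms-cancel antisymmetric₁ k l e))
    where
    open Terms 3 2 0
    num≈ : ∀ k → termNum 6 k *P qpow (2 ℕ.* k) Q.≈ numerator k
    num≈ k = Q.*-cong (termNum≈ 6 k) (qpow≈ (2 ℕ.* k))
    den≈ : ∀ k → termDen 6 k Q.≈ denominator k
    -- The missing power of q appears in `denominator` as q^(0 k), which reduces to 1.
    den≈ k = Q.trans (termDen≈ 6 k) (Q.sym (Q.*-identityʳ _))

  second : sumR (map (λ k → termNum 4 k / termDen 4 k) (upTo (suc m))) ≡R polyR zeroP mod P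
  second = sum≡0 (λ k → termNum 4 k / termDen 4 k) (λ k k≤m → Regular-termDen 4 k k≤m)
    (λ k l e → cross (num≈ k) (den≈ k) (num≈ l) (den≈ l) (terms-cancel antisymmetric₂ k l e))
    where
    open Terms 2 0 0
    num≈ : ∀ k → termNum 4 k Q.≈ numerator k
    num≈ k = Q.trans (termNum≈ 4 k) (Q.sym (Q.*-identityʳ _))
    den≈ : ∀ k → termDen 4 k Q.≈ denominator k
    den≈ k = Q.trans (termDen≈ 4 k) (Q.sym (Q.*-identityʳ _))

  third : sumR (map (λ k → termNum 2 k / (termDen 2 k *P qpow (2 ℕ.* k))) (upTo (suc m))) ≡R polyR zeroP mod P
  third = sum≡0 (λ k → termNum 2 k / (termDen 2 k *P qpow (2 ℕ.* k)))
    (λ k k≤m → Regular-* {termDen 2 k} {qpow (2 ℕ.* k)} (Regular-termDen 2 k k≤m) (Regular-qpow (2 ℕ.* k)))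
    (λ k l e → cross (num≈ k) (den≈ k) (num≈ l) (den≈ l) (terms-cancel antisymmetric₃ k l e))
    where
    open Terms 1 0 2
    num≈ : ∀ k → termNum 2 k Q.≈ numerator k
    num≈ k = Q.trans (termNum≈ 2 k) (Q.sym (Q.*-identityʳ _))
    den≈ : ∀ k → termDen 2 k *P qpow (2 ℕ.* k) Q.≈ denominator k
    den≈ k = Q.*-cong (termDen≈ 2 k) (qpow≈ (2 ℕ.* k))

theorem9p1 : (n : ℕ) → 1 < n → n % 3 ≡ 1 →
    (S₁ n ≡R polyR zeroP mod Φ n) × (S₂ n ≡R polyR zeroP mod Φ n) × (S₃ n ≡R polyR zeroP mod Φ n)
theorem9p1 n 1<n n%3≡1 = ≡.subst Claim (≡.sym n≡) (≡.subst Claim′ (≡.sym m≡) (first , second , third))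
  where
  m = n ℕ./ 3
  n≡ : n ≡ 1 ℕ.+ 3 ℕ.* m
  n≡ = ≡.trans (ℕ.m≡m%n+[m/n]*n n 3) (≡.cong₂ ℕ._+_ n%3≡1 (ℕ.*-comm m 3))
  m≡ : (3 ℕ.* m) ℕ./ 3 ≡ m
  m≡ = ≡.trans (≡.cong (ℕ._/ 3) (ℕ.*-comm 3 m)) (ℕ.m*n/n≡m m 3)
  1<1+3m : 1 ℕ.< 1 ℕ.+ 3 ℕ.* m
  1<1+3m = ≡.subst (1 ℕ.<_) n≡ 1<n
  module C = Cyclotomic (cyclotomic (1 ℕ.+ 3 ℕ.* m) (ℕ.s≤s ℕ.z≤n))
  geometric-cong : ∀ k → geometric (X ^ 1) k ≋ geometric X k
  geometric-cong zero    = refl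
  geometric-cong (suc k) = +-congˡ {x = oneP} (*-cong (*-identityʳ X) (geometric-cong k))
  open Congruence m (Φ (1 ℕ.+ 3 ℕ.* m)) (C.primitive-Φ (ℕ.s≤s ℕ.z≤n)) C.divisor
    -- The divisor g = 1 of n gives that Φ_n divides [n]; this is where n > 1 enters.
    (∣-resp {Φ (1 ℕ.+ 3 ℕ.* m)} refl (geometric-cong (1 ℕ.+ 3 ℕ.* m)) (C.cofactor 1 (1 ℕ.+ 3 ℕ.* m) 1<1+3m (≡.sym (ℕ.*-identityʳ (1 ℕ.+ 3 ℕ.* m)))))
    (C.comaximal (ℕ.s≤s ℕ.z≤n)) using (first; second; third)
  Claim : ℕ → Set
  Claim n = (S₁ n ≡R polyR zeroP mod Φ n) × (S₂ n ≡R polyR zeroP mod Φ n) × (S₃ n ≡R polyR zeroP mod Φ n)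
  -- For n = 1 + 3m the bound (n - 1)/3 of the range reduces to (3m)/3. Abstracting this bound alone
  -- lets it be replaced by m while the modulus stays fixed.
  Claim′ : ℕ → Set
  Claim′ k =
    (sumR (map (λ k → (termNum 6 k *P qpow (2 ℕ.* k)) / termDen 6 k) (upTo (suc k))) ≡R polyR zeroP mod Φ (1 ℕ.+ 3 ℕ.* m)) ×
    (sumR (map (λ k → termNum 4 k / termDen 4 k) (upTo (suc k))) ≡R polyR zeroP mod Φ (1 ℕ.+ 3 ℕ.* m)) ×
    (sumR (map (λ k → termNum 2 k / (termDen 2 k *P qpow (2 ℕ.* k))) (upTo (suc k))) ≡R polyR zeroP mod Φ (1 ℕ.+ 3 ℕ.* m))
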